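{- For any fixed nonnegative integer $f$, every $n$-vertex unweighted undirected graph $G=(V,E)$ admits an $(f+1)$-fault-tolerant exact distance labeling scheme in which each vertex receives a label of $\widetilde{O}\left(n^{2-1/2^f}\right)$ bits.
   Context: An $(f+1)$-fault-tolerant exact distance labeling scheme for $G=(V,E)$ assigns a bitstring label $L(v)$ to each vertex $v\in V$ such that there is a decoding procedure which, for any vertices $s,t$ and any edge set $F\subseteq E$ with $|F|\le f+1$, computes $\mathrm{dist}_{G\setminus F}(s,t)$ using only $L(s)$, $L(t)$ and an explicit description of $F$ (no other information about $G$). $\widetilde{O}$ hides polylogarithmic factors in $n$. -}

module Defs where

open import Data.Nat using (ℕ; zero; suc; _≤_)
open import Data.Fin using (Fin; toℕ)
open import Data.Bool using (Bool; true; false)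
open import Data.Maybe using (Maybe; just; nothing)
open import Data.Product using (_×_; _,_; proj₁; proj₂)
open import Data.List using (List)
open import Data.List.Membership.Propositional using (_∈_)
open import Relation.Nullary using (¬_)
open import Relation.Binary.PropositionalEquality using (_≡_)

record Graph (n : ℕ) : Set where
  field
    adj    : Fin n → Fin n → Bool
    sym    : ∀ u v → adj u v ≡ adj v u
    irrefl : ∀ u → adj u u ≡ false
open Graph public

IsEdge : ∀ {n} → Graph n → Fin n × Fin n → Set
IsEdge G e = adj G (proj₁ e) (proj₂ e) ≡ true

AdjMinus : ∀ {n} → Graph n → List (Fin n × Fin n) → Fin n → Fin n → Set
AdjMinus G F u v = (adj G u v ≡ true) × (¬ ((u , v) ∈ F)) × (¬ ((v , u) ∈ F))

data Walk {n} (G : Graph n) (F : List (Fin n × Fin n)) : Fin n → Fin n → ℕ → Set where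
  nil  : ∀ {u} → Walk G F u u zero
  cons : ∀ {u v w k} → AdjMinus G F u v → Walk G F v w k → Walk G F u w (suc k)

IsDist : ∀ {n} → Graph n → List (Fin n × Fin n) → Fin n → Fin n → Maybe ℕ → Set
IsDist G F s t (just d) = Walk G F s t d × (∀ k → Walk G F s t k → d ≤ k)
IsDist G F s t nothing  = ∀ k → ¬ Walk G F s t k

encodeEdge : ∀ {n} → Fin n × Fin n → ℕ × ℕ
encodeEdge (u , v) = toℕ u , toℕ v

{-# OPTIONS --safe #-}
-- Tie-breaking.  There are arc weights w with w u v + w v u constant for which lightest walks are
-- shortest and, in every subgraph, two lightest walks with the same ends use the same edges.  Let
-- F = {e} ∪ F′ and let P be a shortest s-t walk of G ∖ F.  Take the first x on P such that the
-- lightest walk in G ∖ F′ from s to the successor y of x uses e.  If the lightest walk in G ∖ F′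
-- from t to x used e as well, then either both walks cross e in the same direction and P is not
-- shortest, or they cross it in opposite directions and the antisymmetry of w gives a
-- contradiction.  So P can be replaced by two lightest walks s → x and t → x of G ∖ F′, where
-- |F′| ≤ f, and it suffices that each label stores an f-fault-tolerant preserver of its vertex.
--
-- Preservers.  For a target v and a set S of σ sources, keep a set E of predecessors of v with
-- |E| ≲ n (σ/n)^(1/2^f), by induction on f.  With d ≈ √(n/σ), let T consist of S and the last d
-- vertices of a lightest walk from each source.  If a fault has both ends in T, delete the arcs
-- inside T: what follows the last visit to T is a walk from one of the ≈ σd ≈ √(σn) sources in T
-- with one fault fewer.  Otherwise either the lightest walk survives or a fault is at distance
-- more than d from v; then every replacement walk crosses each of the levels 1, …, d of the
-- distance to v, one of which has at most n/d ≈ √(σn) vertices, and after its last visit to that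
-- level it stays inside a ball which does not contain the far fault.
module Submission where

open import Defs hiding (sym)
open import Data.Nat using (ℕ; zero; suc; _≤_; _<_; _*_; _+_; _^_; _∸_; _⊓_; _⊔_; z≤n; s≤s; NonZero; >-nonZero)
open import Data.Nat.Properties
open import Data.Nat.DivMod using (_%_; [m+kn]%n≡m%n; m<n⇒m%n≡m)
open import Data.Nat.Logarithm using (⌊log₂_⌋; ⌊log₂⌋-mono-≤; ⌊log₂[2^n]⌋≡n; ⌊log₂[2*b]⌋≡1+⌊log₂b⌋)
open import Data.Nat.Binary using (ℕᵇ; 2[1+_]; 1+[2_]; fromℕ) renaming (zero to 0ᵇ; toℕ to toℕᵇ)
open import Data.Nat.Binary.Properties using (toℕ-fromℕ)
open import Data.Nat.Tactic.RingSolver using (solve-∀)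
open import Data.Fin using (Fin; toℕ; fromℕ<; combine) renaming (zero to fzero; suc to fsuc)
import Data.Fin.Properties as Fin
open import Data.Bool using (Bool; true; false)
open import Data.Bool.Properties using () renaming (_≟_ to _≟ᵇ_)
open import Data.Maybe using (Maybe; just; nothing)
open import Data.Empty using (⊥; ⊥-elim)
open import Data.Product using (Σ; ∃; ∃₂; ∃-syntax; _×_; _,_; proj₁; proj₂)
open import Data.Product.Properties using (≡-dec)
open import Data.Sum using (_⊎_; inj₁; inj₂)
open import Data.List using (List; []; _∷_; _++_; length; map; filter; concatMap; allFin)
open import Data.List.Properties using (length-++; length-map; length-tabulate; length-filter)
open import Data.List.Relation.Unary.All using (All)
open import Data.List.Relation.Unary.Any as Any using (here; there)
open import Data.List.Membership.Propositional using (_∈_; lose; find)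
open import Data.List.Membership.Propositional.Properties using (∈-++⁺ˡ; ∈-++⁺ʳ; ∈-++⁻; ∈-map⁺; ∈-map⁻; ∈-concatMap⁺; ∈-filter⁺; ∈-filter⁻; ∈-allFin)
import Data.List.Membership.DecPropositional as DecMembership
open import Function using (_∘_; id)
open import Relation.Nullary using (¬_; Dec; yes; no; contradiction; _×-dec_; _⊎-dec_; ¬?)
open import Relation.Nullary.Decidable using (decidable-stable)
open import Relation.Binary using (Rel; Decidable; Symmetric; _⇒_)
open import Relation.Binary.PropositionalEquality using (_≡_; _≢_; refl; sym; trans; cong; cong₂; subst)
open import Relation.Binary.Construct.Closure.ReflexiveTransitive as Star using (Star; ε; _◅_; _◅◅_)
open import Relation.Binary.Construct.Closure.ReflexiveTransitive.Properties using (gmap-◅◅)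
open import Level using (0ℓ)

-- Walks

module _ {V : Set} where

  private variable
    K H : Rel V 0ℓ
    s t u : V

  total : (V → V → ℕ) → Star K s t → ℕ
  total g ε = 0
  total g (_◅_ {u} {v} _ p) = g u v + total g p

  len : Star K s t → ℕ
  len = total (λ _ _ → 1)

  total-◅◅ : ∀ (g : V → V → ℕ) (p : Star K s t) (q : Star K t u) →
             total g (p ◅◅ q) ≡ total g p + total g q
  total-◅◅ g ε q = refl
  total-◅◅ g (_◅_ {u} {v} _ p) q =
    trans (cong (g u v +_) (total-◅◅ g p q)) (sym (+-assoc (g u v) (total g p) (total g q)))

  total-map : ∀ (g : V → V → ℕ) (i : K ⇒ H) (p : Star K s t) → total g (Star.map {U = H} i p) ≡ total g p
  total-map g i ε = refl
  total-map g i (_◅_ {u} {v} _ p) = cong (g u v +_) (total-map g i p)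

  len-reverse : (i : Symmetric K) (p : Star K s t) → ∃ λ (q : Star K t s) → len q ≡ len p
  len-reverse i ε = ε , refl
  len-reverse i (k ◅ p) with q , eq ← len-reverse i p =
    q ◅◅ (i k ◅ ε) , trans (total-◅◅ _ q (i k ◅ ε)) (trans (cong (_+ 1) eq) (+-comm (len p) 1))

  Minimal : (V → V → ℕ) → Star K s t → Set
  Minimal {K = K} {s} {t} g p = ∀ (q : Star K s t) → total g p ≤ total g q

  infixl 6 _∖_
  _∖_ : Rel V 0ℓ → List (V × V) → Rel V 0ℓ
  (K ∖ F) u v = K u v × ¬ ((u , v) ∈ F) × ¬ ((v , u) ∈ F)

  unsnoc : (p : Star K s t) → s ≢ t →
           ∃ λ x → ∃₂ λ (q : Star K s x) (k : K x t) → p ≡ q ◅◅ (k ◅ ε)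
  unsnoc ε s≢t = contradiction refl s≢t
  unsnoc {K = K} (k ◅ p) _ = go k p
    where
    go : ∀ {s u t} (k : K s u) (p : Star K u t) →
         ∃ λ x → ∃₂ λ (q : Star K s x) (l : K x t) → k ◅ p ≡ q ◅◅ (l ◅ ε)
    go k ε = _ , ε , k , refl
    go k (k′ ◅ p) with x , q , l , eq ← go k′ p = x , k ◅ q , l , cong (k ◅_) eq

  -- The tail `p₂` carries in its type that it stays outside `B`, so it is not a walk of `K` itself.
  -- The decomposition of `p` is therefore recorded through totals, not as an equation between
  -- walks.
  LastExit : (K : Rel V 0ℓ) (B : V → Set) (s t : V) → Star K s t → Set
  LastExit K B s t p = ∃₂ λ x y → B x × ¬ B y × Σ (Star K s x) λ p₁ → K x y ×
    Σ (Star (λ a b → K a b × ¬ B a × ¬ B b) y t) λ p₂ →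
    ∀ g → total g p ≡ total g p₁ + (g x y + total g p₂)

  lastExit : ∀ {B : V → Set} (B? : ∀ x → Dec (B x)) (p : Star K s t) → B s → ¬ B t → LastExit K B s t p
  lastExit {K = K} {t = t} {B = B} B? p Bs ¬Bt with go p
    where
    go : ∀ {s} (p : Star K s t) →
         (¬ B s × Σ (Star (λ a b → K a b × ¬ B a × ¬ B b) s t) λ q → ∀ g → total g p ≡ total g q)
         ⊎ LastExit K B s t p
    go ε = inj₁ (¬Bt , ε , λ g → refl)
    go (_◅_ {i} {j} k p) with go p
    ... | inj₂ (x , y , Bx , ¬By , p₁ , l , p₂ , eq) =
      inj₂ (x , y , Bx , ¬By , k ◅ p₁ , l , p₂ ,
            λ g → trans (cong (g i j +_) (eq g)) (sym (+-assoc (g i j) (total g p₁) (g x y + total g p₂))))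
    ... | inj₁ (¬Bj , q , eq) with B? i
    ...   | yes Bi = inj₂ (i , j , Bi , ¬Bj , ε , k , q , λ g → cong (g i j +_) (eq g))
    ...   | no ¬Bi = inj₁ (¬Bi , (k , ¬Bi , ¬Bj) ◅ q , λ g → cong (g i j +_) (eq g))
  ... | inj₁ (¬Bs , _) = contradiction Bs ¬Bs
  ... | inj₂ e = e

-- Walks on finitely many vertices

module _ {n : ℕ} where

  open DecMembership (≡-dec (Fin._≟_ {n}) (Fin._≟_ {n})) public using (_∈?_)

  private variable
    L : Rel (Fin n) 0ℓ
    a b : Fin n

  Hits : List (Fin n × Fin n) → Fin n → Fin n → Set
  Hits F a b = ((a , b) ∈ F) ⊎ ((b , a) ∈ F)

  firstHit : ∀ F (p : Star L a b) →
    (Σ (Star (L ∖ F) a b) λ q → Star.map proj₁ q ≡ p)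
    ⊎ ∃₂ λ u v → Hits F u v × Σ (Star (L ∖ F) a u) λ p₁ → Σ (L u v) λ k →
        Σ (Star L v b) λ p₂ → p ≡ Star.map proj₁ p₁ ◅◅ (k ◅ p₂)
  firstHit F ε = inj₁ (ε , refl)
  firstHit F (_◅_ {i} {j} k p) with (i , j) ∈? F | (j , i) ∈? F
  ... | yes m | _ = inj₂ (i , j , inj₁ m , ε , k , p , refl)
  ... | no _ | yes m = inj₂ (i , j , inj₂ m , ε , k , p , refl)
  ... | no m | no m′ with firstHit F p
  ...   | inj₁ (q , eq) = inj₁ ((k , m , m′) ◅ q , cong (k ◅_) eq)
  ...   | inj₂ (u , v , h , p₁ , l , p₂ , eq) = inj₂ (u , v , h , (k , m , m′) ◅ p₁ , l , p₂ , cong (k ◅_) eq)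

  private
    vertex : (p : Star L a b) → Fin (suc (len p)) → Fin n
    vertex {a = a} p fzero = a
    vertex (k ◅ p) (fsuc i) = vertex p i

    prefix : (p : Star L a b) (i : Fin (suc (len p))) → Σ (Star L a (vertex p i)) λ q → len q ≡ toℕ i
    prefix p fzero = ε , refl
    prefix (k ◅ p) (fsuc i) with q , eq ← prefix p i = k ◅ q , cong suc eq

    suffix : (p : Star L a b) (i : Fin (suc (len p))) → Σ (Star L (vertex p i) b) λ q → toℕ i + len q ≡ len p
    suffix p fzero = p , refl
    suffix (k ◅ p) (fsuc i) with q , eq ← suffix p i = q , cong suc eq

  -- A walk with `n` or more arcs lists more than `n` vertices, so two of them coincide and the loop
  -- between them can be cut out.
  shorten : (p : Star L a b) → n ≤ len p → ∃ λ (q : Star L a b) → len q < len p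
  shorten {L = L} {b = b} p n≤ with Fin.pigeonhole (s≤s n≤) (vertex p)
  ... | i , j , i<j , eq with prefix p i | suffix p j
  ...   | q , qi | r , rj = q ◅◅ r′ , ≤-trans (≤-reflexive (cong suc (total-◅◅ _ q r′)))
          (≤-trans (+-monoˡ-≤ (len r′) (subst (_< toℕ j) (sym qi) i<j)) (≤-reflexive (trans (cong (toℕ j +_) (len-r′ eq)) rj)))
    where
    r′ = subst (λ z → Star L z b) (sym eq) r
    len-r′ : ∀ {x y} (eq : x ≡ y) {r : Star L y b} → len (subst (λ z → Star L z b) (sym eq) r) ≡ len r
    len-r′ refl = refl

  shrink : (p : Star L a b) → ∃ λ (q : Star L a b) → len q ≤ len p × len q ≤ n
  shrink {L = L} {a} {b} p = go (len p) p ≤-refl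
    where
    go : ∀ k (p : Star L a b) → len p ≤ k → ∃ λ (q : Star L a b) → len q ≤ len p × len q ≤ n
    go k p p≤k with len p ≤? n
    ... | yes p≤n = p , ≤-refl , p≤n
    go zero p p≤k | no p≰n = contradiction (≤-trans p≤k z≤n) p≰n
    go (suc k) p p≤k | no p≰n with q , q<p ← shorten p (<⇒≤ (≰⇒> p≰n))
                            with r , r≤q , r≤n ← go k q (≤-pred (≤-trans q<p p≤k)) =
      r , ≤-trans r≤q (<⇒≤ q<p) , r≤n

  -- Exhaustive search over first arcs. Every arc consumes at least 1 of the budget `m`, so the fuel
  -- `k` never runs out before the budget does.
  within? : Decidable L → (g : Fin n → Fin n → ℕ) → (∀ u v → 1 ≤ g u v) → ∀ m a b →
            Dec (∃ λ (p : Star L a b) → total g p ≤ m)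
  within? {L = L} L? g g>0 m a b = go m m a ≤-refl
    where
    go : ∀ k m a → m ≤ k → Dec (∃ λ (p : Star L a b) → total g p ≤ m)
    go k m a m≤k with a Fin.≟ b
    go k m a m≤k | yes refl = yes (ε , z≤n)
    go zero .zero a z≤n | no a≢b = no λ
      { (ε , _) → a≢b refl
      ; (_◅_ {_} {j} _ p , le) → <⇒≱ (≤-trans (g>0 a j) (m≤m+n (g a j) (total g p))) le }
    go (suc k) m a m≤k | no a≢b with Fin.any? (λ c → L? a c ×-dec ((g a c ≤? m) ×-dec go k (m ∸ g a c) c (le c)))
      where
      le : ∀ c → m ∸ g a c ≤ k
      le c = ∸-mono m≤k (g>0 a c)
    ... | yes (c , l , g≤m , p , le) =
      yes (l ◅ p , ≤-trans (+-monoʳ-≤ (g a c) le) (≤-reflexive (m+[n∸m]≡n g≤m)))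
    ... | no ¬c = no λ
      { (ε , _) → a≢b refl
      ; (_◅_ {_} {c} l p , le) → ¬c (c , l , ≤-trans (m≤m+n (g a c) (total g p)) le , p ,
          ≤-trans (≤-reflexive (sym (m+n∸m≡n (g a c) (total g p)))) (∸-monoˡ-≤ (g a c) le)) }

  minimal : Decidable L → (g : Fin n → Fin n → ℕ) → (∀ u v → 1 ≤ g u v) →
            Star L a b → ∃ λ (p : Star L a b) → Minimal g p
  minimal {L = L} {a} {b} L? g g>0 p = go (total g p) p ≤-refl
    where
    go : ∀ k (p : Star L a b) → total g p ≤ k → ∃ λ (p : Star L a b) → Minimal g p
    go zero p p≤k = p , λ q → ≤-trans p≤k z≤n
    go (suc k) p p≤k with within? L? g g>0 k a b
    ... | yes (q , q≤k) = go k q q≤k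
    ... | no none = p , λ q → ≤-trans p≤k (≰⇒> (λ q≤k → none (q , q≤k)))

  -- By `shrink`, a search with unit weights and budget `n` is already complete.
  reachable? : Decidable L → Decidable (Star L)
  reachable? L? a b with within? L? (λ _ _ → 1) (λ _ _ → s≤s z≤n) n a b
  ... | yes (p , _) = yes p
  ... | no none = no λ p → let q , _ , q≤n = shrink p in none (q , q≤n)

-- Positional notation, least significant digit first

eval : ℕ → ℕ → (ℕ → ℕ) → ℕ
eval D zero a = 0
eval D (suc k) a = a 0 + D * eval D k (a ∘ suc)

eval-cong : ∀ D k {a b : ℕ → ℕ} → (∀ q → a q ≡ b q) → eval D k a ≡ eval D k b
eval-cong D zero eq = refl
eval-cong D (suc k) eq = cong₂ (λ x y → x + D * y) (eq 0) (eval-cong D k (eq ∘ suc))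

eval-+ : ∀ D k (a b : ℕ → ℕ) → eval D k (λ q → a q + b q) ≡ eval D k a + eval D k b
eval-+ D zero a b = refl
eval-+ D (suc k) a b rewrite eval-+ D k (a ∘ suc) (b ∘ suc) = rearrange (a 0) (b 0) D _ _
  where
  rearrange : ∀ x y D e f → x + y + D * (e + f) ≡ x + D * e + (y + D * f)
  rearrange = solve-∀

eval-0 : ∀ D k → eval D k (λ _ → 0) ≡ 0
eval-0 D zero = refl
eval-0 D (suc k) rewrite eval-0 D k = *-zeroʳ D

module _ (D : ℕ) .{{_ : NonZero D}} where

  eval-top-≤ : ∀ N a → a N * D ^ N ≤ eval D (suc N) a
  eval-top-≤ zero a = ≤-trans (≤-reflexive (*-identityʳ (a 0))) (m≤m+n (a 0) _)
  eval-top-≤ (suc N) a = begin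
    a (suc N) * (D * D ^ N)               ≡⟨ rearrange (a (suc N)) D (D ^ N) ⟩
    D * (a (suc N) * D ^ N)               ≤⟨ *-monoʳ-≤ D (eval-top-≤ N (a ∘ suc)) ⟩
    D * eval D (suc N) (a ∘ suc)          ≤⟨ m≤n+m _ (a 0) ⟩
    a 0 + D * eval D (suc N) (a ∘ suc)    ∎
    where
    open ≤-Reasoning
    rearrange : ∀ x y z → x * (y * z) ≡ y * (x * z)
    rearrange = solve-∀

  -- Without carries, the positions below `N` contribute less than one unit of position `N`.
  eval-top-< : ∀ N a → (∀ q → q < N → a q < D) → eval D (suc N) a < suc (a N) * D ^ N
  eval-top-< zero a a<D rewrite *-zeroʳ D | *-identityʳ (a 0) | +-identityʳ (a 0) = ≤-refl
  eval-top-< (suc N) a a<D = begin-strict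
    a 0 + D * e                       <⟨ +-monoˡ-< (D * e) (a<D 0 (s≤s z≤n)) ⟩
    D + D * e                         ≡⟨ *-suc D e ⟨
    D * suc e                         ≤⟨ *-monoʳ-≤ D (eval-top-< N (a ∘ suc) (λ q q<N → a<D (suc q) (s≤s q<N))) ⟩
    D * (suc (a (suc N)) * D ^ N)     ≡⟨ rearrange D (suc (a (suc N))) (D ^ N) ⟩
    suc (a (suc N)) * (D * D ^ N)     ∎
    where
    open ≤-Reasoning
    e = eval D (suc N) (a ∘ suc)
    rearrange : ∀ x y z → x * (y * z) ≡ y * (x * z)
    rearrange = solve-∀

  eval-injective : ∀ k a b → (∀ q → q < k → a q < D) → (∀ q → q < k → b q < D) →
                   eval D k a ≡ eval D k b → ∀ q → q < k → a q ≡ b q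
  eval-injective (suc k) a b a<D b<D eq = λ
    { zero _ → a₀≡b₀
    ; (suc q) (s≤s q<k) → eval-injective k (a ∘ suc) (b ∘ suc)
        (λ q q<k → a<D (suc q) (s≤s q<k)) (λ q q<k → b<D (suc q) (s≤s q<k)) rest q q<k }
    where
    low : ∀ (c : ℕ → ℕ) e → c 0 < D → (c 0 + D * e) % D ≡ c 0
    low c e c<D = trans (cong (λ z → (c 0 + z) % D) (*-comm D e))
                        (trans ([m+kn]%n≡m%n (c 0) e D) (m<n⇒m%n≡m c<D))
    a₀≡b₀ : a 0 ≡ b 0
    a₀≡b₀ = trans (sym (low a _ (a<D 0 (s≤s z≤n)))) (trans (cong (_% D) eq) (low b _ (b<D 0 (s≤s z≤n))))
    rest : eval D k (a ∘ suc) ≡ eval D k (b ∘ suc)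
    rest = *-cancelˡ-≡ _ _ D (+-cancelˡ-≡ (b 0) _ _ (trans (cong (_+ _) (sym a₀≡b₀)) eq))

-- An antisymmetric tie-breaking weight

indicator : ℕ → ℕ → ℕ
indicator q c with q ≟ c
... | yes _ = 1
... | no _ = 0

indicator≤1 : ∀ q c → indicator q c ≤ 1
indicator≤1 q c with q ≟ c
... | yes _ = s≤s z≤n
... | no _ = z≤n

indicator-≢ : ∀ {q c} → q ≢ c → indicator q c ≡ 0
indicator-≢ {q} {c} q≢c with q ≟ c
... | yes eq = contradiction eq q≢c
... | no _ = refl

indicator-≡ : ∀ q → indicator q q ≡ 1
indicator-≡ q with q ≟ q
... | yes _ = refl
... | no q≢q = contradiction refl q≢q

module _ {n : ℕ} where

  code : Fin n → Fin n → ℕ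
  code u v = toℕ (combine u v)

  code-injective : ∀ {u v u′ v′} → code u v ≡ code u′ v′ → u ≡ u′ × v ≡ v′
  code-injective {u} {v} {u′} {v′} eq = Fin.combine-injective u v u′ v′ (Fin.toℕ-injective eq)

  -- The antisymmetric indicator of an arc minus that of its reverse, shifted by 1 to remain a
  -- natural number. Since `suc` comes before the subtraction, `∸` never truncates.
  digit : Fin n → Fin n → ℕ → ℕ
  digit u v q = suc (indicator q (code u v)) ∸ indicator q (code v u)

  digit-antisym : ∀ u v q → digit u v q + digit v u q ≡ 2
  digit-antisym u v q with q ≟ code u v | q ≟ code v u
  ... | yes _ | yes _ = refl
  ... | yes _ | no _ = refl
  ... | no _ | yes _ = refl
  ... | no _ | no _ = refl

  digit≤2 : ∀ u v q → digit u v q ≤ 2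
  digit≤2 u v q = ≤-trans (m∸n≤m _ (indicator q (code v u))) (s≤s (indicator≤1 q (code u v)))

  digit-other : ∀ u v {q} → q ≢ code u v → q ≢ code v u → digit u v q ≡ 1
  digit-other u v q≢ q≢′ rewrite indicator-≢ q≢ | indicator-≢ q≢′ = refl

  digit-≥1 : ∀ u v {q} → q ≢ code v u → 1 ≤ digit u v q
  digit-≥1 u v {q} q≢ rewrite indicator-≢ q≢ = s≤s z≤n

  digit-self : ∀ {u v} → u ≢ v → digit u v (code u v) ≡ 2
  digit-self {u} {v} u≢v
    rewrite indicator-≡ (code u v) | indicator-≢ {code u v} {code v u} (u≢v ∘ proj₁ ∘ code-injective) = refl

  -- A walk of at most `n` arcs has digit sums at most `n * 2`, so in this base its cost has no
  -- carries. Position `top` lies just above all values of `code`.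
  base top : ℕ
  base = suc (n * 2)
  top = n * n

  digit-top : ∀ u v → digit u v top ≡ 1
  digit-top u v = digit-other u v (top≢ u v) (top≢ v u)
    where
    top≢ : ∀ u v → top ≢ code u v
    top≢ u v eq = <⇒≢ (Fin.toℕ<n (combine u v)) (sym eq)

  -- The leading digit counts arcs, so lighter walks are never longer; the digit at code u v
  -- is 2 for (u , v), 0 for (v , u) and 1 for every other arc.
  weight : Fin n → Fin n → ℕ
  weight u v = eval base (suc top) (digit u v)

  weight-antisym : ∀ u v x y → weight u v + weight v u ≡ weight x y + weight y x
  weight-antisym u v x y = trans (const u v) (sym (const x y))
    where
    const : ∀ u v → weight u v + weight v u ≡ eval base (suc top) (λ _ → 2)
    const u v = trans (sym (eval-+ base (suc top) (digit u v) (digit v u)))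
                      (eval-cong base (suc top) (digit-antisym u v))

  weight>0 : ∀ u v → 1 ≤ weight u v
  weight>0 u v = ≤-trans (≤-trans (m^n>0 base top) (≤-reflexive (sym (+-identityʳ _))))
    (≤-trans (≤-reflexive (cong (_* base ^ top) (sym (digit-top u v)))) (eval-top-≤ base top (digit u v)))

  private variable
    K : Rel (Fin n) 0ℓ
    s t u v : Fin n

  cost : Star K s t → ℕ
  cost = total weight

  digits : Star K s t → ℕ → ℕ
  digits p q = total (λ u v → digit u v q) p

  cost-eval : (p : Star K s t) → cost p ≡ eval base (suc top) (digits p)
  cost-eval ε = sym (eval-0 base (suc top))
  cost-eval (_◅_ {u} {v} _ p) =
    trans (cong (weight u v +_) (cost-eval p)) (sym (eval-+ base (suc top) (digit u v) (digits p)))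

  digits-top : (p : Star K s t) → digits p top ≡ len p
  digits-top ε = refl
  digits-top (_◅_ {u} {v} _ p) = cong₂ _+_ (digit-top u v) (digits-top p)

  digits≤ : (p : Star K s t) → ∀ q → digits p q ≤ len p * 2
  digits≤ ε q = z≤n
  digits≤ (_◅_ {u} {v} _ p) q = +-mono-≤ (digit≤2 u v q) (digits≤ p q)

  digits<base : (p : Star K s t) → len p ≤ n → ∀ q → digits p q < base
  digits<base p p≤n q = s≤s (≤-trans (digits≤ p q) (*-monoˡ-≤ 2 p≤n))

  -- The lengths are the leading digits. Only `q` has to be free of carries: carries in `p` can only
  -- make it more expensive.
  cost≤⇒len≤ : (p q : Star K s t) → len q ≤ n → cost p ≤ cost q → len p ≤ len q
  cost≤⇒len≤ p q q≤n le = ≤-pred (*-cancelʳ-< (base ^ top) (len p) (suc (len q)) (begin-strict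
    len p * base ^ top            ≡⟨ cong (_* base ^ top) (digits-top p) ⟨
    digits p top * base ^ top     ≤⟨ eval-top-≤ base top (digits p) ⟩
    eval base (suc top) (digits p) ≡⟨ cost-eval p ⟨
    cost p                        ≤⟨ le ⟩
    cost q                        ≡⟨ cost-eval q ⟩
    eval base (suc top) (digits q) <⟨ eval-top-< base top (digits q) (λ i _ → digits<base q q≤n i) ⟩
    suc (digits q top) * base ^ top ≡⟨ cong (λ z → suc z * base ^ top) (digits-top q) ⟩
    suc (len q) * base ^ top      ∎))
    where open ≤-Reasoning

  cost-minimal⇒shortest : (p : Star K s t) → Minimal weight p → ∀ (q : Star K s t) → len p ≤ len q
  cost-minimal⇒shortest p min q with r , r≤q , r≤n ← shrink q = ≤-trans (cost≤⇒len≤ p r r≤n (min r)) r≤q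

  cost-minimal⇒len≤n : (p : Star K s t) → Minimal weight p → len p ≤ n
  cost-minimal⇒len≤n p min with r , _ , r≤n ← shrink p = ≤-trans (cost-minimal⇒shortest p min r) r≤n

  -- Only the arc from `v` to `u` can have digit 0 at `code u v`. Either every arc of `p`
  -- contributes there, or `p` splits at that arc.
  reverse-arc : ∀ u v (p : Star K s t) → len p ≤ digits p (code u v)
    ⊎ ∃₂ λ (p₁ : Star K s v) (p₂ : Star K u t) → len p ≡ len p₁ + suc (len p₂)
  reverse-arc u v ε = inj₁ z≤n
  reverse-arc {s = s} {t} u v (_◅_ {i} {j} k p) with reverse-arc u v p
  ... | inj₂ (p₁ , p₂ , eq) = inj₂ (k ◅ p₁ , p₂ , cong suc eq)
  ... | inj₁ le = decide (code u v ≟ code j i)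
    where
    decide : Dec (code u v ≡ code j i) → suc (len p) ≤ digit i j (code u v) + digits p (code u v)
      ⊎ ∃₂ λ (p₁ : Star _ s v) (p₂ : Star _ u t) → suc (len p) ≡ len p₁ + suc (len p₂)
    decide (no ≢) = inj₁ (+-mono-≤ (digit-≥1 i j ≢) le)
    decide (yes eq) with refl , refl ← code-injective eq = inj₂ (ε , p , refl)

  digits-avoid : ∀ {u v e} → Hits (e ∷ []) u v → (p : Star (K ∖ (e ∷ [])) s t) → digits p (code u v) ≡ len p
  digits-avoid h ε = refl
  digits-avoid {u = u} {v} {e} h (_◅_ {i} {j} (_ , ∉ , ∉′) p) =
    cong₂ _+_ (digit-other i j (¬same h) (¬swapped h)) (digits-avoid h p)
    where
    ¬same : Hits (e ∷ []) u v → code u v ≢ code i j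
    ¬same h eq with code-injective eq
    ¬same (inj₁ m) eq | refl , refl = ∉ m
    ¬same (inj₂ m) eq | refl , refl = ∉′ m
    ¬swapped : Hits (e ∷ []) u v → code u v ≢ code j i
    ¬swapped h eq with code-injective eq
    ¬swapped (inj₁ m) eq | refl , refl = ∉′ m
    ¬swapped (inj₂ m) eq | refl , refl = ∉ m

  -- This is the uniqueness given by tie-breaking. Minimal walks have at most `n` arcs, so equal
  -- costs force equal digit sums at every position. At `code u v` the walk `q`, which avoids `e`,
  -- collects exactly 1 per arc, while `p` collects 2 from its crossing and at least 1 from each
  -- other arc.
  minimal-avoids : ∀ {e} (p : Star K s t) → Minimal weight p →
    (q : Star (K ∖ (e ∷ [])) s t) → cost q ≤ cost p →
    ∀ (p₁ : Star K s u) k (p₂ : Star K v t) → Hits (e ∷ []) u v → p ≡ p₁ ◅◅ (k ◅ p₂) → ⊥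
  minimal-avoids {K = K} {u = u} {v} p min q q≤p p₁ k p₂ h refl
    with reverse-arc u v p₁ | reverse-arc u v p₂
  -- If `p` also crosses from `v` to `u`, before or after the given crossing, leaving out the round
  -- trip gives a shorter walk.
  ... | inj₂ (a , b , eq) | _ = <⇒≱ (begin-strict
      len (a ◅◅ p₂)                        ≡⟨ total-◅◅ _ a p₂ ⟩
      len a + len p₂                       ≤⟨ +-monoˡ-≤ (len p₂) (≤-trans (m≤m+n (len a) _) (≤-reflexive (sym eq))) ⟩
      len p₁ + len p₂                      <⟨ +-monoʳ-< (len p₁) ≤-refl ⟩
      len p₁ + suc (len p₂)                ≡⟨ total-◅◅ _ p₁ (k ◅ p₂) ⟨
      len (p₁ ◅◅ (k ◅ p₂))                 ∎) (cost-minimal⇒shortest p min (a ◅◅ p₂))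
    where open ≤-Reasoning
  ... | inj₁ _ | inj₂ (a , b , eq) = <⇒≱ (begin-strict
      len (p₁ ◅◅ b)                        ≡⟨ total-◅◅ _ p₁ b ⟩
      len p₁ + len b                       <⟨ +-monoʳ-< (len p₁) (s≤s (≤-trans (n≤1+n _) (≤-trans (m≤n+m _ (len a)) (≤-reflexive (sym eq))))) ⟩
      len p₁ + suc (len p₂)                ≡⟨ total-◅◅ _ p₁ (k ◅ p₂) ⟨
      len (p₁ ◅◅ (k ◅ p₂))                 ∎) (cost-minimal⇒shortest p min (p₁ ◅◅ b))
    where open ≤-Reasoning
  ... | inj₁ le₁ | inj₁ le₂ = <⇒≱ (begin-strict
      len p                                ≡⟨ total-◅◅ _ p₁ (k ◅ p₂) ⟩
      len p₁ + suc (len p₂)                <⟨ +-mono-≤-< le₁ (s≤s (s≤s le₂)) ⟩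
      digits p₁ c + (2 + digits p₂ c)      ≡⟨ cong (λ z → digits p₁ c + (z + digits p₂ c)) (digit-self u≢v) ⟨
      digits p₁ c + (digit u v c + digits p₂ c) ≡⟨ total-◅◅ _ p₁ (k ◅ p₂) ⟨
      digits p c                           ≡⟨ sameDigits c (≤-trans (Fin.toℕ<n (combine u v)) (n≤1+n top)) ⟩
      digits q′ c                          ≡⟨ total-map _ proj₁ q ⟩
      digits q c                           ≡⟨ digits-avoid h q ⟩
      len q                                ≡⟨ total-map _ proj₁ q ⟨
      len q′                               ≤⟨ cost-minimal⇒shortest q′ min′ p ⟩
      len p                                ∎) ≤-refl
    where
    open ≤-Reasoning
    c = code u v
    q′ : Star K _ _
    q′ = Star.map proj₁ q
    q′≤p : cost q′ ≤ cost p
    q′≤p = ≤-trans (≤-reflexive (total-map weight proj₁ q)) q≤p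
    min′ : Minimal weight q′
    min′ r = ≤-trans q′≤p (min r)
    sameDigits : ∀ i → i < suc top → digits p i ≡ digits q′ i
    sameDigits = eval-injective base (suc top) (digits p) (digits q′)
      (λ i _ → digits<base p (cost-minimal⇒len≤n p min) i)
      (λ i _ → digits<base q′ (cost-minimal⇒len≤n q′ min′) i)
      (trans (sym (cost-eval p)) (trans (≤-antisym (min q′) q′≤p) (cost-eval q′)))
    u≢v : u ≢ v
    u≢v refl = <⇒≱ (begin-strict
      len (p₁ ◅◅ p₂)                       ≡⟨ total-◅◅ _ p₁ p₂ ⟩
      len p₁ + len p₂                      <⟨ +-monoʳ-< (len p₁) ≤-refl ⟩
      len p₁ + suc (len p₂)                ≡⟨ total-◅◅ _ p₁ (k ◅ p₂) ⟨
      len (p₁ ◅◅ (k ◅ p₂))                 ∎) (cost-minimal⇒shortest p min (p₁ ◅◅ p₂))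

-- The size of a preserver

^-distribʳ-* : ∀ a b k → (a * b) ^ k ≡ a ^ k * b ^ k
^-distribʳ-* a b zero = refl
^-distribʳ-* a b (suc k) rewrite ^-distribʳ-* a b k = rearrange a b (a ^ k) (b ^ k)
  where
  rearrange : ∀ a b x y → a * b * (x * y) ≡ a * x * (b * y)
  rearrange = solve-∀

^-double : ∀ a f → a ^ (2 ^ suc f) ≡ a ^ (2 ^ f) * a ^ (2 ^ f)
^-double a f = trans (^-distribˡ-+-* a (2 ^ f) _) (cong (λ k → a ^ (2 ^ f) * a ^ k) (+-identityʳ (2 ^ f)))

suc-2^∸1 : ∀ f → suc (2 ^ f ∸ 1) ≡ 2 ^ f
suc-2^∸1 f = m+[n∸m]≡n (m^n>0 2 f)

^-double∸1 : ∀ a f → a ^ (2 ^ suc f ∸ 1) ≡ a * (a ^ (2 ^ f ∸ 1) * a ^ (2 ^ f ∸ 1))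
^-double∸1 a f = trans (cong (a ^_) exponent) (cong (a *_) (^-distribˡ-+-* a m m))
  where
  m = 2 ^ f ∸ 1
  exponent : 2 ^ suc f ∸ 1 ≡ suc (m + m)
  exponent = trans (cong (λ k → k + (k + 0) ∸ 1) (sym (suc-2^∸1 f)))
                   (trans (cong (λ k → m + suc k) (+-identityʳ m)) (+-suc m m))

-- N ≤ C · σ^(1/2^f) · n^(1 - 1/2^f)
Small : (n f C σ N : ℕ) → Set
Small n f C σ N = N ^ (2 ^ f) ≤ C ^ (2 ^ f) * (σ * n ^ (2 ^ f ∸ 1))

-- Expanding the power of a sum is avoided by bounding the sum by twice the maximum, which accounts
-- for the factor 2.
small-+ : ∀ n f C σ {N M} → Small n f C σ N → Small n f C σ M → Small n f (2 * C) σ (N + M)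
small-+ n f C σ {N} {M} sN sM = begin
  (N + M) ^ p                          ≤⟨ ^-monoˡ-≤ p sum≤ ⟩
  (2 * (N ⊔ M)) ^ p                    ≡⟨ ^-distribʳ-* 2 (N ⊔ M) p ⟩
  2 ^ p * (N ⊔ M) ^ p                  ≤⟨ *-monoʳ-≤ (2 ^ p) sup ⟩
  2 ^ p * (C ^ p * X)                  ≡⟨ *-assoc (2 ^ p) (C ^ p) X ⟨
  2 ^ p * C ^ p * X                    ≡⟨ cong (_* X) (^-distribʳ-* 2 C p) ⟨
  (2 * C) ^ p * X                      ∎
  where
  open ≤-Reasoning
  p = 2 ^ f
  X = σ * n ^ (p ∸ 1)
  sum≤ : N + M ≤ 2 * (N ⊔ M)
  sum≤ = +-mono-≤ (m≤m⊔n N M) (≤-trans (m≤n⊔m N M) (≤-reflexive (sym (+-identityʳ _))))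
  sup : (N ⊔ M) ^ p ≤ C ^ p * X
  sup with ⊔-sel N M
  ... | inj₁ eq rewrite eq = sN
  ... | inj₂ eq rewrite eq = sM

small-all : ∀ n f C σ .{{_ : NonZero C}} → n ≤ σ → Small n f C σ n
small-all n f C σ n≤σ = begin
  n ^ p                     ≡⟨ cong (n ^_) (suc-2^∸1 f) ⟨
  n * n ^ (p ∸ 1)           ≤⟨ *-monoˡ-≤ (n ^ (p ∸ 1)) n≤σ ⟩
  σ * n ^ (p ∸ 1)           ≡⟨ *-identityˡ _ ⟨
  1 * (σ * n ^ (p ∸ 1))     ≤⟨ *-monoˡ-≤ _ (m^n>0 C p) ⟩
  C ^ p * (σ * n ^ (p ∸ 1)) ∎
  where
  open ≤-Reasoning
  p = 2 ^ f

-- Squaring the bound doubles the exponent `2 ^ f` and produces `σ′ * σ′`, which is about `σ * n`.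
-- The constant 16 is then moved under the power, where it only grows.
small-suc : ∀ n f C {σ σ′ N} → σ′ * σ′ ≤ 16 * (σ * n) → Small n f C σ′ N → Small n (suc f) (16 * C) σ N
small-suc n f C {σ} {σ′} {N} σ′≤ s = begin
  N ^ (2 ^ suc f)                                 ≡⟨ ^-double N f ⟩
  N ^ p * N ^ p                                   ≤⟨ *-mono-≤ s s ⟩
  C ^ p * (σ′ * m) * (C ^ p * (σ′ * m))           ≡⟨ gather (C ^ p) σ′ m ⟩
  σ′ * σ′ * (C ^ p * C ^ p * (m * m))             ≤⟨ *-monoˡ-≤ _ σ′≤ ⟩
  16 * (σ * n) * (C ^ p * C ^ p * (m * m))        ≡⟨ spread 16 σ n (C ^ p * C ^ p) (m * m) ⟩
  16 * (C ^ p * C ^ p) * (σ * (n * (m * m)))      ≡⟨ cong₂ (λ c e → 16 * c * (σ * e)) (^-double C f) (^-double∸1 n f) ⟨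
  16 * C ^ q * (σ * n ^ (q ∸ 1))                  ≤⟨ *-monoˡ-≤ _ (*-monoˡ-≤ (C ^ q) (≤-trans (≤-reflexive (sym (^-identityʳ 16))) (^-monoʳ-≤ 16 (m^n>0 2 (suc f))))) ⟩
  16 ^ q * C ^ q * (σ * n ^ (q ∸ 1))              ≡⟨ cong (_* (σ * n ^ (q ∸ 1))) (^-distribʳ-* 16 C q) ⟨
  (16 * C) ^ q * (σ * n ^ (q ∸ 1))                ∎
  where
  open ≤-Reasoning
  p = 2 ^ f
  q = 2 ^ suc f
  m = n ^ (p ∸ 1)
  gather : ∀ c s m → c * (s * m) * (c * (s * m)) ≡ s * s * (c * c * (m * m))
  gather = solve-∀
  spread : ∀ k s n c m → k * (s * n) * (c * m) ≡ k * c * (s * (n * m))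
  spread = solve-∀

-- An integer stand-in for the square root of n/σ. The lower bound limits the number of hubs, the
-- upper bound the size of a thin level.
scale : ∀ σ n → 1 ≤ σ → ∃ λ d → σ * (d * d) ≤ n × n ≤ σ * (suc d * suc d)
scale σ zero 1≤σ = 0 , ≤-reflexive (*-zeroʳ σ) , z≤n
scale σ (suc n) 1≤σ with d , lo , hi ← scale σ n 1≤σ with suc n ≤? σ * (suc d * suc d)
... | yes hi′ = d , m≤n⇒m≤1+n lo , hi′
... | no ¬hi = suc d , m≤n⇒m≤1+n (≤-pred (≰⇒> ¬hi)) , (begin
  suc n                           ≤⟨ +-mono-≤ 1≤σ hi ⟩
  σ + σ * (suc d * suc d)         ≡⟨ *-suc σ (suc d * suc d) ⟨
  σ * suc (suc d * suc d)         ≤⟨ *-monoʳ-≤ σ (≤-trans (m≤m+n _ (2 + 2 * d)) (≤-reflexive (square d))) ⟩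
  σ * (suc (suc d) * suc (suc d)) ∎)
  where
  open ≤-Reasoning
  square : ∀ d → suc (suc d * suc d) + (2 + 2 * d) ≡ suc (suc d) * suc (suc d)
  square = solve-∀

-- For positive `d`, `d + 3` is at most `4 * d`, whence 16. For `d = 0` the bound rests on `σ ≤ n`.
hubs≤ : ∀ σ n d → σ * (d * d) ≤ n → σ ≤ n → (σ * (d + 3)) * (σ * (d + 3)) ≤ 16 * (σ * n)
hubs≤ σ n d σdd≤n σ≤n = begin
  σ * (d + 3) * (σ * (d + 3))  ≡⟨ regroup σ (d + 3) ⟩
  σ * (σ * ((d + 3) * (d + 3))) ≤⟨ *-monoʳ-≤ σ (bound d σdd≤n) ⟩
  σ * (16 * n)                 ≡⟨ swap σ n ⟩
  16 * (σ * n)                 ∎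
  where
  open ≤-Reasoning
  regroup : ∀ a b → a * b * (a * b) ≡ a * (a * (b * b))
  regroup = solve-∀
  swap : ∀ a b → a * (16 * b) ≡ 16 * (a * b)
  swap = solve-∀
  expand : ∀ s d → s * (16 * (suc d * suc d)) ≡ 16 * (s * (suc d * suc d))
  expand = solve-∀
  square : ∀ d → (suc d + 3) * (suc d + 3) + (15 * (d * d) + 24 * d) ≡ 16 * (suc d * suc d)
  square = solve-∀
  bound : ∀ d → σ * (d * d) ≤ n → σ * ((d + 3) * (d + 3)) ≤ 16 * n
  bound zero _ = ≤-trans (*-monoˡ-≤ 9 σ≤n) (≤-trans (≤-reflexive (*-comm n 9)) (*-monoˡ-≤ n (m≤m+n 9 7)))
  bound (suc d) le = begin
    σ * ((suc d + 3) * (suc d + 3))  ≤⟨ *-monoʳ-≤ σ (≤-trans (m≤m+n _ _) (≤-reflexive (square d))) ⟩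
    σ * (16 * (suc d * suc d))       ≡⟨ expand σ d ⟩
    16 * (σ * (suc d * suc d))       ≤⟨ *-monoʳ-≤ 16 le ⟩
    16 * n                           ∎

-- The argument yields `σ * n`; the factor 16 is slack, to match `hubs≤`.
level≤ : ∀ σ n d r → suc d * r ≤ n → n ≤ σ * (suc d * suc d) → r * r ≤ 16 * (σ * n)
level≤ σ n d r dr≤n n≤ = ≤-trans (*-cancelˡ-≤ (suc d * suc d) (begin
  suc d * suc d * (r * r)     ≡⟨ regroup (suc d) r ⟩
  suc d * r * (suc d * r)     ≤⟨ *-mono-≤ dr≤n (≤-trans dr≤n n≤) ⟩
  n * (σ * (suc d * suc d))   ≡⟨ swap n σ (suc d * suc d) ⟩
  suc d * suc d * (σ * n)     ∎)) (m≤n*m (σ * n) 16)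
  where
  open ≤-Reasoning
  regroup : ∀ a b → a * a * (b * b) ≡ a * b * (a * b)
  regroup = solve-∀
  swap : ∀ a b c → a * (b * c) ≡ c * (b * a)
  swap = solve-∀

-- Averaging over the `suc d` layers `ρ 0` to `ρ d`, whose sum is at most `c (suc d)`. The search
-- keeps track of how far `c` must have grown while all layers seen so far were too large.
sparse-level : ∀ (c ρ : ℕ → ℕ) N d → (∀ k → c k + ρ k ≤ c (suc k)) → c (suc d) ≤ N →
               ∃ λ j → j ≤ d × suc d * ρ j ≤ N
sparse-level c ρ N d grow c≤N with search (suc d)
  where
  search : ∀ k → (∃ λ j → j < k × suc d * ρ j ≤ N) ⊎ (k * suc N ≤ suc d * c k)
  search zero = inj₂ z≤n
  search (suc k) with search k
  ... | inj₁ (j , j<k , le) = inj₁ (j , m≤n⇒m≤1+n j<k , le)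
  ... | inj₂ le with suc d * ρ k ≤? N
  ...   | yes small = inj₁ (k , ≤-refl , small)
  ...   | no large = inj₂ (begin
    suc N + k * suc N               ≤⟨ +-mono-≤ (≰⇒> large) le ⟩
    suc d * ρ k + suc d * c k       ≡⟨ *-distribˡ-+ (suc d) (ρ k) (c k) ⟨
    suc d * (ρ k + c k)             ≡⟨ cong (suc d *_) (+-comm (ρ k) (c k)) ⟩
    suc d * (c k + ρ k)             ≤⟨ *-monoʳ-≤ (suc d) (grow k) ⟩
    suc d * c (suc k)               ∎)
    where open ≤-Reasoning
... | inj₁ (j , j<d , le) = j , ≤-pred j<d , le
... | inj₂ le = contradiction (*-cancelˡ-≤ (suc d) le) (<⇒≱ (s≤s c≤N))

length-filter-layer : ∀ {A : Set} {P Q : A → Set} (P? : ∀ x → Dec (P x)) (Q? : ∀ x → Dec (Q x)) →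
  (∀ {x} → P x → Q x) → ∀ xs →
  length (filter P? xs) + length (filter (λ x → Q? x ×-dec ¬? (P? x)) xs) ≤ length (filter Q? xs)
length-filter-layer P? Q? P⇒Q [] = z≤n
length-filter-layer P? Q? P⇒Q (x ∷ xs) with ih ← length-filter-layer P? Q? P⇒Q xs | P? x | Q? x
... | yes _ | yes _ = s≤s ih
... | yes Px | no ¬Qx = contradiction (P⇒Q Px) ¬Qx
... | no _ | yes _ = ≤-trans (≤-reflexive (+-suc _ _)) (s≤s ih)
... | no _ | no _ = ih

length-concatMap : ∀ {A B : Set} (g : A → List B) m xs → (∀ {x} → x ∈ xs → length (g x) ≤ m) →
                   length (concatMap g xs) ≤ length xs * m
length-concatMap g m [] g≤m = z≤n
length-concatMap g m (x ∷ xs) g≤m =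
  ≤-trans (≤-reflexive (length-++ (g x))) (+-mono-≤ (g≤m (here refl)) (length-concatMap g m xs (g≤m ∘ there)))

remove : ∀ {A : Set} {e : A} {F} → e ∈ F →
         ∃ λ F′ → length F ≡ suc (length F′) × (∀ {x} → x ∈ F′ → x ∈ F) × (∀ {x} → x ∈ F → x ≡ e ⊎ x ∈ F′)
remove {F = _ ∷ F} (here refl) = F , refl , there , λ { (here eq) → inj₁ eq ; (there m) → inj₂ m }
remove {F = y ∷ _} (there e∈) with F′ , eq , sub , split ← remove e∈ =
  y ∷ F′ , cong suc eq , (λ { (here eq) → here eq ; (there m) → there (sub m) }) ,
  λ { (here eq) → inj₂ (here eq) ; (there m) → shift (split m) }
  where
  shift : ∀ {x} → x ≡ _ ⊎ x ∈ F′ → x ≡ _ ⊎ x ∈ y ∷ F′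
  shift (inj₁ eq) = inj₁ eq
  shift (inj₂ m) = inj₂ (there m)

-- Fault-tolerant preservers

-- Without faults there are at most 3 hubs per source. Each further fault costs 16 by `small-suc`
-- and 2 by `small-+`.
factor : ℕ → ℕ
factor zero = 3
factor (suc f) = 2 * (16 * factor f)

factor≢0 : ∀ f → NonZero (factor f)
factor≢0 zero = _
factor≢0 (suc f) = m*n≢0 2 (16 * factor f) {{_}} {{m*n≢0 16 (factor f) {{_}} {{factor≢0 f}}}}

module _ {n : ℕ} where

  open DecMembership (Fin._≟_ {n}) using () renaming (_∈?_ to _∈ᵛ?_)

  private variable
    H : Rel (Fin n) 0ℓ
    s t u v x y : Fin n

  -- Only the last arc is controlled; `q` may be any walk of `H ∖ F`. A whole walk is recovered
  -- later by repeating the argument with `x` as the new target.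
  Covers : ℕ → Rel (Fin n) 0ℓ → Fin n → List (Fin n) → List (Fin n) → Set
  Covers f H v S E = ∀ F → length F ≤ f → ∀ {s} → s ∈ S → s ≢ v → (p : Star (H ∖ F) s v) →
    ∃ λ x → x ∈ E × Σ (Star (H ∖ F) s x) λ q → (H ∖ F) x v × cost q + weight x v ≤ cost p

  -- Inside `H′` the fault `(a , b)` is absent anyway, so deleting it from `F` changes nothing there
  -- and leaves at most `f` faults. The smaller preserver then replaces the final part `p₂`.
  reroute : ∀ {f H H′ S E F a b} → Covers f H′ v S E → length F ≤ suc f → (a , b) ∈ F →
    H′ ⇒ H → ¬ H′ a b → ¬ H′ b a →
    (p₁ : Star (H ∖ F) s x) → x ∈ S → x ≢ v → (p₂ : Star (λ c d → (H ∖ F) c d × H′ c d) x v) →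
    ∃ λ y → y ∈ E × Σ (Star (H ∖ F) s y) λ q → (H ∖ F) y v × cost q + weight y v ≤ cost p₁ + cost p₂
  reroute {v} {H = H} {H′} {F = F} {a} {b} cov F≤ e∈ H′⊆H ¬ab ¬ba p₁ x∈S x≢v p₂
    with F′ , eq , F′⊆F , split ← remove e∈ = result (cov F′ (≤-pred (subst (_≤ _) eq F≤)) x∈S x≢v (Star.map forget p₂))
    where
    forget : (λ c d → (H ∖ F) c d × H′ c d) ⇒ (H′ ∖ F′)
    forget ((_ , ∉ , ∉′) , h) = h , ∉ ∘ F′⊆F , ∉′ ∘ F′⊆F
    embed : (H′ ∖ F′) ⇒ (H ∖ F)
    embed {c} {d} (h , ∉ , ∉′) = H′⊆H h , avoid , avoid′
      where
      avoid : ¬ ((c , d) ∈ F)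
      avoid m with split m
      ... | inj₁ refl = ¬ab h
      ... | inj₂ m′ = ∉ m′
      avoid′ : ¬ ((d , c) ∈ F)
      avoid′ m with split m
      ... | inj₁ refl = ¬ba h
      ... | inj₂ m′ = ∉′ m′
    result : _ → _
    result (y , y∈E , q , k , le) = y , y∈E , p₁ ◅◅ Star.map embed q , embed k , (begin
      cost (p₁ ◅◅ Star.map embed q) + weight y v      ≡⟨ cong (_+ weight y v) (total-◅◅ weight p₁ (Star.map embed q)) ⟩
      cost p₁ + cost (Star.map embed q) + weight y v  ≡⟨ cong (λ z → cost p₁ + z + weight y v) (total-map weight embed q) ⟩
      cost p₁ + cost q + weight y v                   ≡⟨ +-assoc (cost p₁) (cost q) (weight y v) ⟩
      cost p₁ + (cost q + weight y v)                 ≤⟨ +-monoʳ-≤ (cost p₁) le ⟩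
      cost p₁ + cost (Star.map forget p₂)             ≡⟨ cong (cost p₁ +_) (total-map weight forget p₂) ⟩
      cost p₁ + cost p₂                               ∎)
      where open ≤-Reasoning

  tail : ℕ → Star H s t → List (Fin n)
  tail {t = t} d ε = t ∷ []
  tail d (_◅_ {i} k p) with suc (len p) ≤? d
  ... | yes _ = i ∷ tail d p
  ... | no _ = tail d p

  length-tail : ∀ d (p : Star H s t) → length (tail d p) ≤ suc (len p ⊓ d)
  length-tail d ε = s≤s z≤n
  length-tail d (k ◅ p) with suc (len p) ≤? d | length-tail d p
  ... | yes p<d | ih rewrite m≤n⇒m⊓n≡m p<d | m≤n⇒m⊓n≡m (<⇒≤ p<d) = s≤s ih
  ... | no p≮d | ih = ≤-trans ih (s≤s (⊓-monoˡ-≤ d (n≤1+n (len p))))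

  start∈tail : ∀ d (p : Star H s t) → len p ≤ d → s ∈ tail d p
  start∈tail d ε _ = here refl
  start∈tail d (k ◅ p) p≤d with suc (len p) ≤? d
  ... | yes _ = here refl
  ... | no ≰ = contradiction p≤d ≰

  arc∈tail : ∀ d (p₁ : Star H s x) (k : H x y) (p₂ : Star H y t) → len p₂ < d →
             x ∈ tail d (p₁ ◅◅ (k ◅ p₂)) × y ∈ tail d (p₁ ◅◅ (k ◅ p₂))
  arc∈tail d ε k p₂ p₂<d with suc (len p₂) ≤? d
  ... | yes _ = here refl , there (start∈tail d p₂ (<⇒≤ p₂<d))
  ... | no ≰ = contradiction p₂<d ≰
  arc∈tail d (l ◅ p₁) k p₂ p₂<d with arc∈tail d p₁ k p₂ p₂<d | suc (len (p₁ ◅◅ (k ◅ p₂))) ≤? d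
  ... | x∈ , y∈ | yes _ = there x∈ , there y∈
  ... | x∈ , y∈ | no _ = x∈ , y∈

  module Hubs (H : Rel (Fin n) 0ℓ) (H? : Decidable H) (v : Fin n) (d : ℕ) where

    best : Star H s v → Star H s v
    best p = proj₁ (minimal H? weight weight>0 p)

    best-minimal : (p : Star H s v) → Minimal weight (best p)
    best-minimal p = proj₂ (minimal H? weight weight>0 p)

    approach : Fin n → List (Fin n)
    approach s with reachable? H? s v
    ... | yes p = tail d (best p)
    ... | no _ = []

    approach≤ : ∀ s → length (approach s) ≤ suc d
    approach≤ s with reachable? H? s v
    ... | yes p = ≤-trans (length-tail d (best p)) (s≤s (m⊓n≤n (len (best p)) d))
    ... | no _ = z≤n

    hubs : List (Fin n) → List (Fin n)
    hubs S = S ++ concatMap approach S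

    length-hubs : ∀ S → length (hubs S) ≤ length S * (2 + d)
    length-hubs S = begin
      length (hubs S)                             ≡⟨ length-++ S ⟩
      length S + length (concatMap approach S)    ≤⟨ +-monoʳ-≤ (length S) (length-concatMap approach (suc d) S (λ {x} _ → approach≤ x)) ⟩
      length S + length S * suc d                 ≡⟨ *-suc (length S) (suc d) ⟨
      length S * (2 + d)                          ∎
      where open ≤-Reasoning

    -- The hubs were computed from the walk returned by `reachable?`; the given walk excludes the
    -- branch in which there is none.
    hub-walk : ∀ {S} → s ∈ S → Star H s v →
      ∃ λ (π : Star H s v) → Minimal weight π × (∀ {x} → x ∈ tail d π → x ∈ hubs S)
    hub-walk {s} {S} s∈S p with reachable? H? s v in eq
    ... | no ¬p = contradiction p ¬p
    ... | yes p′ = best p′ , best-minimal p′ , λ x∈ → ∈-++⁺ʳ S (∈-concatMap⁺ approach (lose s∈S (within x∈)))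
      where
      within : ∀ {x} → x ∈ tail d (best p′) → x ∈ approach s
      within x∈ rewrite eq = x∈

  Ball : Rel (Fin n) 0ℓ → Fin n → ℕ → Fin n → Set
  Ball H v k x = ∃ λ (p : Star H x v) → len p ≤ k

  -- The inclusion of `S` in `E` lets a hub itself be the predecessor of `v` in the induction step.
  Preserver : ℕ → Rel (Fin n) 0ℓ → Fin n → List (Fin n) → Set
  Preserver f H v S = ∃ λ E → Small n f (factor f) (length S) (length E) ×
    (∀ {x} → x ∈ S → x ∈ E) × Covers f H v S E

  trivial-preserver : ∀ f v S → n ≤ length S → Preserver f H v S
  trivial-preserver {H} f v S n≤S = allFin n ,
    subst (Small n f (factor f) (length S)) (sym (length-tabulate {n = n} (λ i → i)))
      (small-all n f (factor f) (length S) {{factor≢0 f}} n≤S) ,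
    (λ {x} _ → ∈-allFin x) , covers
    where
    covers : Covers f H v S (allFin n)
    covers F _ _ s≢v p with unsnoc p s≢v
    ... | x , q , k , refl = x , ∈-allFin x , q , k ,
      ≤-reflexive (trans (cong (cost q +_) (sym (+-identityʳ (weight x v)))) (sym (total-◅◅ weight q (k ◅ ε))))

  -- A surviving lightest walk beats every replacement, and its predecessor of `v` lies in any tail
  -- of depth at least 1.
  direct : ∀ {F d T} → (π : Star H s v) → Minimal weight π → (∀ {x} → x ∈ tail (suc d) π → x ∈ T) →
    s ≢ v → (q : Star (H ∖ F) s v) → Star.map proj₁ q ≡ π → (p : Star (H ∖ F) s v) →
    ∃ λ x → x ∈ T × Σ (Star (H ∖ F) s x) λ q → (H ∖ F) x v × cost q + weight x v ≤ cost p
  direct {v = v} {d = d} π min tail⊆T s≢v q refl p with unsnoc q s≢v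
  ... | x , q₁ , k , refl = x , tail⊆T x∈ , q₁ , k , (begin
      cost q₁ + weight x v                ≡⟨ cong (cost q₁ +_) (+-identityʳ (weight x v)) ⟨
      cost q₁ + (weight x v + 0)          ≡⟨ total-◅◅ weight q₁ (k ◅ ε) ⟨
      cost (q₁ ◅◅ (k ◅ ε))                ≡⟨ total-map weight proj₁ (q₁ ◅◅ (k ◅ ε)) ⟨
      cost π                              ≤⟨ min (Star.map proj₁ p) ⟩
      cost (Star.map proj₁ p)             ≡⟨ total-map weight proj₁ p ⟩
      cost p                              ∎)
    where
    open ≤-Reasoning
    x∈ : x ∈ tail (suc d) π
    x∈ = subst (λ r → x ∈ tail (suc d) r) (sym (gmap-◅◅ id proj₁ q₁ (k ◅ ε)))
           (proj₁ (arc∈tail (suc d) (Star.map proj₁ q₁) (proj₁ k) ε (s≤s z≤n)))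

  preserver₀ : ∀ H → Decidable H → ∀ v S → Preserver 0 H v S
  preserver₀ H H? v S = hubs S , small , ∈-++⁺ˡ , covers
    where
    -- Depth 1 reaches exactly the predecessor of `v`, which is all that is needed when nothing
    -- fails.
    open Hubs H H? v 1
    small : Small n 0 3 (length S) (length (hubs S))
    small = begin
      length (hubs S) * 1          ≡⟨ *-identityʳ _ ⟩
      length (hubs S)              ≤⟨ length-hubs S ⟩
      length S * 3                 ≡⟨ *-comm (length S) 3 ⟩
      3 * length S                 ≡⟨ cong (3 *_) (*-identityʳ (length S)) ⟨
      3 * (length S * 1)           ∎
      where open ≤-Reasoning
    covers : Covers 0 H v S (hubs S)
    covers [] _ s∈S s≢v p with π , min , ⊆hubs ← hub-walk s∈S (Star.map proj₁ p) with firstHit [] π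
    ... | inj₁ (q , eq) = direct π min ⊆hubs s≢v q eq p
    ... | inj₂ (_ , _ , inj₁ () , _)
    ... | inj₂ (_ , _ , inj₂ () , _)

  -- The induction step: one more fault

  module Step (f : ℕ) (H : Rel (Fin n) 0ℓ) (H? : Decidable H) (irr : ∀ {u} → ¬ H u u) (v : Fin n)
              (S : List (Fin n)) (d : ℕ) where

    -- With depth `suc d`, an arc of a hub walk can have an end outside `T` only if more than `d`
    -- arcs follow it.
    open Hubs H H? v (suc d)

    T : List (Fin n)
    T = hubs S

    Far : Rel (Fin n) 0ℓ
    Far a b = H a b × ¬ (a ∈ T × b ∈ T)

    Far? : Decidable Far
    Far? a b = H? a b ×-dec ¬? ((a ∈ᵛ? T) ×-dec (b ∈ᵛ? T))

    Ball? : ∀ k x → Dec (Ball H v k x)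
    Ball? k x = within? H? (λ _ _ → 1) (λ _ _ → ≤-refl) k x v

    Near : ℕ → Rel (Fin n) 0ℓ
    Near k a b = H a b × Ball H v k a × Ball H v k b

    Near? : ∀ k → Decidable (Near k)
    Near? k a b = H? a b ×-dec (Ball? k a ×-dec Ball? k b)

    Level? : ∀ k x → Dec (Ball H v (suc k) x × ¬ Ball H v k x)
    Level? k x = Ball? (suc k) x ×-dec ¬? (Ball? k x)

    -- Index `k` stands for distance exactly `suc k` to `v` in `H`, so level 0 consists of vertices
    -- at distance 1.
    level : ℕ → List (Fin n)
    level k = filter (Level? k) (allFin n)

    thin-level : ∃ λ j → j ≤ d × suc d * length (level j) ≤ n
    thin-level = sparse-level (λ k → length (filter (Ball? k) (allFin n))) (λ k → length (level k)) n d
      (λ k → length-filter-layer (Ball? k) (Ball? (suc k)) (λ (p , le) → p , m≤n⇒m≤1+n le) (allFin n))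
      (≤-trans (length-filter (Ball? (suc d)) (allFin n)) (≤-reflexive (length-tabulate {n = n} (λ i → i))))

    module _ (j : ℕ) (j≤d : j ≤ d) {E₁ E₂ : List (Fin n)} (T⊆E₁ : ∀ {x} → x ∈ T → x ∈ E₁)
             (cov₁ : Covers f Far v T E₁) (cov₂ : Covers f (Near (suc j)) v (level j) E₂) where

      Found : List (Fin n × Fin n) → (s : Fin n) → ℕ → Set
      Found F s c = ∃ λ x → x ∈ E₁ ++ E₂ × Σ (Star (H ∖ F) s x) λ q → (H ∖ F) x v × cost q + weight x v ≤ c

      -- After the last visit to a hub other than `v`, the walk uses only `Far` arcs, and the fault
      -- is not one of these.
      near-fault : ∀ {F a b s} → length F ≤ suc f → (a , b) ∈ F → a ∈ T → b ∈ T →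
                   s ∈ T → s ≢ v → (p : Star (H ∖ F) s v) → Found F s (cost p)
      near-fault {F} {a} {b} {s} F≤ e∈ a∈T b∈T s∈T s≢v p
        -- Tails end in `v`, so `v` is usually a hub and has to be excluded for an exit to exist.
        with lastExit (λ x → (x ∈ᵛ? T) ×-dec ¬? (x Fin.≟ v)) p (s∈T , s≢v) (λ (_ , v≢v) → v≢v refl)
      ... | x , y , (x∈T , x≢v) , ¬By , p₁ , k , p₂ , eq with y Fin.≟ v
      ...   | yes refl = x , ∈-++⁺ˡ (T⊆E₁ x∈T) , p₁ , k ,
              ≤-trans (+-monoʳ-≤ (cost p₁) (m≤m+n (weight x v) (cost p₂))) (≤-reflexive (sym (eq weight)))
      ...   | no y≢v with reroute cov₁ F≤ e∈ proj₁ (λ (_ , ∉) → ∉ (a∈T , b∈T)) (λ (_ , ∉) → ∉ (b∈T , a∈T))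
                            p₁ x∈T x≢v ((k , proj₁ k , λ (_ , y∈T) → ¬By (y∈T , y≢v)) ◅ Star.map outside p₂)
        where
        outside : (λ a b → (H ∖ F) a b × ¬ (a ∈ T × a ≢ v) × ¬ (b ∈ T × b ≢ v)) ⇒ (λ a b → (H ∖ F) a b × Far a b)
        outside {a} {b} (h , ¬Ba , ¬Bb) = h , proj₁ h , λ (a∈T , b∈T) → loop a∈T b∈T
          where
          -- Outside the exit set, an arc between hubs could only be a loop at `v`.
          loop : a ∈ T → b ∈ T → ⊥
          loop a∈T b∈T with a Fin.≟ v | b Fin.≟ v
          ... | no a≢v | _ = ¬Ba (a∈T , a≢v)
          ... | yes _ | no b≢v = ¬Bb (b∈T , b≢v)
          ... | yes refl | yes refl = irr (proj₁ h)
      ... | z , z∈ , q , l , le = z , ∈-++⁺ˡ z∈ , q , l , ≤-trans le (≤-reflexive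
              (trans (cong (λ c → cost p₁ + (weight x y + c)) (total-map weight _ p₂)) (sym (eq weight))))

      -- The last exit from the complement of the ball of radius `j` leaves from a vertex at
      -- distance exactly `suc j`, a source of the second preserver. What follows stays in the ball
      -- of radius `suc j`, where the fault is not an arc.
      far-fault : ∀ {F a b s} → length F ≤ suc f → (a , b) ∈ F → ¬ Near (suc j) a b → ¬ Near (suc j) b a →
                  ¬ Ball H v j s → (p : Star (H ∖ F) s v) → Found F s (cost p)
      far-fault {F} {a} {b} {s} F≤ e∈ ¬ab ¬ba ¬Bs p
        with x , y , ¬Bx , ¬¬By , p₁ , k , p₂ , eq ← lastExit (λ x → ¬? (Ball? j x)) p ¬Bs (λ ¬Bv → ¬Bv (ε , z≤n))
        = found
        where
        inBall : ∀ {z} → ¬ ¬ Ball H v j z → Ball H v j z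
        inBall {z} = decidable-stable (Ball? j z)
        wider : ∀ {z} → Ball H v j z → Ball H v (suc j) z
        wider (r , le) = r , m≤n⇒m≤1+n le
        By = inBall ¬¬By
        Bx : Ball H v (suc j) x
        Bx = proj₁ k ◅ proj₁ By , s≤s (proj₂ By)
        x≢v : x ≢ v
        x≢v refl = ¬Bx (ε , z≤n)
        inside : (λ a b → (H ∖ F) a b × ¬ ¬ Ball H v j a × ¬ ¬ Ball H v j b) ⇒ (λ a b → (H ∖ F) a b × Near (suc j) a b)
        inside (h , Ba , Bb) = h , proj₁ h , wider (inBall Ba) , wider (inBall Bb)
        found : Found F s (cost p)
        found with reroute cov₂ F≤ e∈ proj₁ ¬ab ¬ba p₁ (∈-filter⁺ (Level? j) (∈-allFin x) (Bx , ¬Bx)) x≢v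
                     ((k , proj₁ k , Bx , wider By) ◅ Star.map inside p₂)
        ... | z , z∈ , q , l , le = z , ∈-++⁺ʳ E₁ z∈ , q , l , ≤-trans le (≤-reflexive
                (trans (cong (λ c → cost p₁ + (weight x y + c)) (total-map weight inside p₂)) (sym (eq weight))))

      covers : Covers (suc f) H v S (E₁ ++ E₂)
      covers F F≤ {s} s∈S s≢v p with Any.any? (λ (a , b) → (a ∈ᵛ? T) ×-dec (b ∈ᵛ? T)) F
      ... | yes near with (a , b) , e∈ , a∈T , b∈T ← find near = near-fault F≤ e∈ a∈T b∈T (∈-++⁺ˡ s∈S) s≢v p
      ... | no ¬near with π , min , ⊆hubs ← hub-walk s∈S (Star.map proj₁ p) with firstHit F π
      ...   | inj₁ (q , eq) = widen (direct π min ⊆hubs s≢v q eq p)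
        where
        widen : _ → Found F s (cost p)
        widen (x , x∈T , rest) = x , ∈-++⁺ˡ (T⊆E₁ x∈T) , rest
      ...   | inj₂ (a , b , hit , p₁ , k , p₂ , refl) = far hit
        where
        open ≤-Reasoning
        π₁ = Star.map proj₁ p₁
        -- A suffix of a shortest walk is shortest.
        distance : ∀ (r : Star H a v) → suc (len p₂) ≤ len r
        distance r = +-cancelˡ-≤ (len π₁) _ _ (begin
          len π₁ + suc (len p₂)       ≡⟨ total-◅◅ _ π₁ (k ◅ p₂) ⟨
          len (π₁ ◅◅ (k ◅ p₂))        ≤⟨ cost-minimal⇒shortest (π₁ ◅◅ (k ◅ p₂)) min (π₁ ◅◅ r) ⟩
          len (π₁ ◅◅ r)               ≡⟨ total-◅◅ _ π₁ r ⟩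
          len π₁ + len r              ∎)
        faraway : ¬ (a ∈ T × b ∈ T) → suc d ≤ len p₂
        faraway ¬T with suc d ≤? len p₂
        ... | yes le = le
        ... | no ≰ with a∈ , b∈ ← arc∈tail (suc d) π₁ k p₂ (≰⇒> ≰) = contradiction (⊆hubs a∈ , ⊆hubs b∈) ¬T
        -- The vertex `a` is at distance at least `d + 2`, while `suc j` is at most `d + 1`.
        ¬Ba : ¬ (a ∈ T × b ∈ T) → ¬ Ball H v (suc j) a
        ¬Ba ¬T (r , le) = <⇒≱ (≤-trans (s≤s (faraway ¬T)) (distance r)) (≤-trans le (s≤s j≤d))
        ¬Bs : ¬ (a ∈ T × b ∈ T) → ¬ Ball H v j s
        ¬Bs ¬T (r , le) = <⇒≱ (begin-strict
          j                           <⟨ s≤s j≤d ⟩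
          suc d                       ≤⟨ faraway ¬T ⟩
          len p₂                      ≤⟨ n≤1+n _ ⟩
          suc (len p₂)                ≤⟨ m≤n+m _ (len π₁) ⟩
          len π₁ + suc (len p₂)       ≡⟨ total-◅◅ _ π₁ (k ◅ p₂) ⟨
          len (π₁ ◅◅ (k ◅ p₂))        ≤⟨ cost-minimal⇒shortest (π₁ ◅◅ (k ◅ p₂)) min r ⟩
          len r                       ∎) le
        far : Hits F a b → Found F s (cost p)
        far (inj₁ e∈) = far-fault F≤ e∈ (λ (_ , Ba , _) → ¬Ba ¬T Ba) (λ (_ , _ , Ba) → ¬Ba ¬T Ba) (¬Bs ¬T) p
          where ¬T = λ both → ¬near (lose e∈ both)
        far (inj₂ e∈) = far-fault F≤ e∈ (λ (_ , _ , Ba) → ¬Ba ¬T Ba) (λ (_ , Ba , _) → ¬Ba ¬T Ba) (¬Bs ¬T) p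
          where ¬T = λ (a∈T , b∈T) → ¬near (lose e∈ (b∈T , a∈T))

  preserver : ∀ f H → Decidable H → (∀ {u} → ¬ H u u) → ∀ v S → Preserver f H v S
  preserver zero H H? irr v S = preserver₀ H H? v S
  -- Treated apart because `scale` divides by the number of sources.
  preserver (suc f) H H? irr v [] = [] , ≤-trans (≤-reflexive (0^2^ (suc f))) z≤n , (λ ()) , λ _ _ ()
    where
    0^2^ : ∀ f → 0 ^ (2 ^ f) ≡ 0
    0^2^ f = cong (0 ^_) (sym (suc-2^∸1 f))
  preserver (suc f) H H? irr v S@(_ ∷ _) with length S ≤? n
  -- The estimate `hubs≤` relies on at most `n` sources; with more, keeping all vertices is within
  -- the bound.
  ... | no ≰ = trivial-preserver (suc f) v S (<⇒≤ (≰⇒> ≰))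
  ... | yes S≤n with d , lo , hi ← scale (length S) n (s≤s z≤n)
                with j , j≤d , thin ← Step.thin-level f H H? irr v S d
                with E₁ , small₁ , T⊆E₁ , cov₁ ← preserver f (Step.Far f H H? irr v S d) (Step.Far? f H H? irr v S d)
                                                   (irr ∘ proj₁) v (Step.T f H H? irr v S d)
                with E₂ , small₂ , _ , cov₂ ← preserver f (Step.Near f H H? irr v S d (suc j)) (Step.Near? f H H? irr v S d (suc j))
                                                (irr ∘ proj₁) v (Step.level f H H? irr v S d j)
    = E₁ ++ E₂ ,
      subst (Small n (suc f) (factor (suc f)) σ) (sym (length-++ E₁))
        (small-+ n (suc f) (16 * factor f) σ
          (small-suc n f (factor f) {σ} {length (Step.T f H H? irr v S d)} (≤-trans (*-mono-≤ hubs-bound hubs-bound) (hubs≤ σ n d lo S≤n)) small₁)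
          (small-suc n f (factor f) {σ} {length (Step.level f H H? irr v S d j)} (level≤ σ n d _ thin hi) small₂)) ,
      (λ x∈S → ∈-++⁺ˡ (T⊆E₁ (∈-++⁺ˡ x∈S))) ,
      Step.covers f H H? irr v S d j j≤d T⊆E₁ cov₁ cov₂
    where
    σ = length S
    hubs-bound : length (Step.T f H H? irr v S d) ≤ σ * (d + 3)
    hubs-bound = ≤-trans (Hubs.length-hubs H H? v (suc d) S) (≤-reflexive (cong (σ *_) (+-comm 3 d)))

-- Restoration by concatenation

module _ {n : ℕ} where

  private variable
    A K : Rel (Fin n) 0ℓ
    s t u v x y : Fin n

  firstUse : ∀ e → A ⇒ K → (p : Star A s t) →
    (∃ λ (q : Star (A ∖ (e ∷ [])) s t) → ∀ g → total g q ≡ total g p)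
    ⊎ ∃₂ λ u v → Hits (e ∷ []) u v × Σ (Star (K ∖ (e ∷ [])) s u) λ p₁ → K u v ×
        Σ (Star K v t) λ p₂ → ∀ g → total g p ≡ total g p₁ + (g u v + total g p₂)
  firstUse {K = K} e A⇒K p with firstHit (e ∷ []) p
  ... | inj₁ (q , refl) = inj₁ (q , λ g → sym (total-map g proj₁ q))
  ... | inj₂ (u , v , hit , p₁ , k , p₂ , refl) = inj₂ (u , v , hit , Star.map into p₁ , A⇒K k , Star.map A⇒K p₂ , λ g →
    trans (total-◅◅ g (Star.map proj₁ p₁) (k ◅ p₂)) (cong₂ (λ a b → a + (g u v + b))
      (trans (total-map g proj₁ p₁) (sym (total-map g into p₁))) (sym (total-map g A⇒K p₂))))
    where
    into : (_ ∖ (e ∷ [])) ⇒ (K ∖ (e ∷ []))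
    into (a , avoid) = A⇒K a , avoid

  module Restoration (K : Rel (Fin n) 0ℓ) (K-sym : Symmetric K) (e : Fin n × Fin n) where

    K⁻ : Rel (Fin n) 0ℓ
    K⁻ = K ∖ (e ∷ [])

    K⁻-sym : Symmetric K⁻
    K⁻-sym (k , ∉ , ∉′) = K-sym k , ∉′ , ∉

    Optimal : (s t : Fin n) → ℕ → Set
    Optimal s t c = ∀ (r : Star K s t) → c ≤ cost r

    -- The lightest walks `a` from `s` to `y` and `b` from `t` to `x` cannot both cross `e` when `x`
    -- and `y` are consecutive on a shortest walk avoiding `e`. The two possible relative directions
    -- are refuted separately.
    no-crossing : (pa : Star K⁻ s x) (k : K⁻ x y) (pb : Star K⁻ y t) →
      (∀ (r : Star K⁻ s t) → len pa + suc (len pb) ≤ len r) →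
      (q : Star K⁻ s x) → Optimal s x (cost q) →
      ∀ {u v} → Hits (e ∷ []) u v → (a₁ : Star K⁻ s u) (l : K u v) (a₂ : Star K v y) →
      Optimal s y (cost a₁ + (weight u v + cost a₂)) →
      ∀ {u′ v′} → Hits (e ∷ []) u′ v′ → (b₁ : Star K⁻ t u′) (m : K u′ v′) (b₂ : Star K v′ x) →
      Optimal t x (cost b₁ + (weight u′ v′ + cost b₂)) → ⊥
    no-crossing {s} {x} {y} {t} pa k pb shortest q q-opt {u} {v} hit a₁ l a₂ a-opt {u′} {v′} hit′ b₁ m b₂ b-opt =
      orient hit hit′
      where
      open ≤-Reasoning
      forget : ∀ {s t} → Star K⁻ s t → Star K s t
      forget = Star.map proj₁
      cost-forget : ∀ {s t} (p : Star K⁻ s t) → cost (forget p) ≡ cost p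
      cost-forget = total-map weight proj₁
      len-forget : ∀ {s t} (p : Star K⁻ s t) → len (forget p) ≡ len p
      len-forget = total-map (λ _ _ → 1) proj₁
      a : Star K s y
      a = forget a₁ ◅◅ (l ◅ a₂)
      b : Star K t x
      b = forget b₁ ◅◅ (m ◅ b₂)
      cost-a : cost a ≡ cost a₁ + (weight u v + cost a₂)
      cost-a = trans (total-◅◅ weight (forget a₁) (l ◅ a₂)) (cong (_+ _) (cost-forget a₁))
      cost-b : cost b ≡ cost b₁ + (weight u′ v′ + cost b₂)
      cost-b = trans (total-◅◅ weight (forget b₁) (m ◅ b₂)) (cong (_+ _) (cost-forget b₁))
      a-min : Minimal weight a
      a-min r = ≤-trans (≤-reflexive cost-a) (a-opt r)
      b-min : Minimal weight b
      b-min r = ≤-trans (≤-reflexive cost-b) (b-opt r)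

      cost-snoc : cost (q ◅◅ (k ◅ ε)) ≡ cost q + weight x y
      cost-snoc = trans (total-◅◅ weight q (k ◅ ε)) (cong (cost q +_) (+-identityʳ (weight x y)))

      -- Tie-breaking makes the optimal walk to y unique, so the detour through x loses strictly.
      detour-loses : cost a₁ + (weight u v + cost a₂) < cost q + weight x y
      detour-loses = ≰⇒> λ le → minimal-avoids a a-min (q ◅◅ (k ◅ ε))
        (≤-trans (≤-reflexive cost-snoc) (≤-trans le (≤-reflexive (sym cost-a)))) (forget a₁) l a₂ hit refl

      -- Together `a` and `b` have at most two arcs more than `pa` and `pb`, and each spends one on
      -- `e`. So `a₁` followed by `b₁` reversed avoids `e` and is shorter than the walk through `x`
      -- and `y`.
      same : u ≡ u′ → ⊥
      same refl with rb , rb-len ← len-reverse K⁻-sym b₁ = <⇒≱ (begin-strict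
        len a₁ + len b₁                            <⟨ s≤s (+-mono-≤ (m≤m+n (len a₁) (len a₂)) (m≤m+n (len b₁) (len b₂))) ⟩
        suc (len a₁ + len a₂ + (len b₁ + len b₂))  ≤⟨ ≤-pred (begin
          2 + (len a₁ + len a₂ + (len b₁ + len b₂))            ≡⟨ shuffle (len a₁) (len a₂) (len b₁) (len b₂) ⟩
          len a₁ + suc (len a₂) + (len b₁ + suc (len b₂))      ≡⟨ cong₂ _+_ len-a len-b ⟨
          len a + len b                                       ≤⟨ +-mono-≤ a≤ b≤ ⟩
          suc (len pa) + suc (len pb)                         ∎) ⟩
        len pa + suc (len pb)                      ≤⟨ shortest (a₁ ◅◅ rb) ⟩
        len (a₁ ◅◅ rb)                             ≡⟨ trans (total-◅◅ _ a₁ rb) (cong (len a₁ +_) rb-len) ⟩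
        len a₁ + len b₁                            ∎) ≤-refl
        where
        shuffle : ∀ a b c d → 2 + (a + b + (c + d)) ≡ a + suc b + (c + suc d)
        shuffle = solve-∀
        len-a : len a ≡ len a₁ + suc (len a₂)
        len-a = trans (total-◅◅ _ (forget a₁) (l ◅ a₂)) (cong (_+ _) (len-forget a₁))
        len-b : len b ≡ len b₁ + suc (len b₂)
        len-b = trans (total-◅◅ _ (forget b₁) (m ◅ b₂)) (cong (_+ _) (len-forget b₁))
        a≤ : len a ≤ suc (len pa)
        a≤ = ≤-trans (cost-minimal⇒shortest a a-min (forget (pa ◅◅ (k ◅ ε))))
          (≤-reflexive (trans (len-forget (pa ◅◅ (k ◅ ε))) (trans (total-◅◅ _ pa (k ◅ ε)) (+-comm (len pa) 1))))
        b≤ : len b ≤ suc (len pb)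
        b≤ with r , eq ← len-reverse K⁻-sym (k ◅ pb) =
          ≤-trans (cost-minimal⇒shortest b b-min (forget r)) (≤-reflexive (trans (len-forget r) eq))

      -- The walks are exchanged at `e`: `a₁` continues with `b₂` to `x`, and `b₁` continues with
      -- `a₂` to `y` and back to `x`. Both crossings of `e` are saved at the price of the arc from
      -- `y` to `x`. By `weight-antisym` and `detour-loses` the new pair is lighter than `q` and
      -- `b`, contradicting their minimality.
      opposite : u ≡ v′ → v ≡ u′ → ⊥
      opposite refl refl = <⇒≱ (begin-strict
        cost q + cost b                                     ≤⟨ +-mono-≤ (q-opt (forget a₁ ◅◅ b₂)) (b-min (forget b₁ ◅◅ (a₂ ◅◅ (K-sym (proj₁ k) ◅ ε)))) ⟩
        cost (forget a₁ ◅◅ b₂) + cost (forget b₁ ◅◅ (a₂ ◅◅ (K-sym (proj₁ k) ◅ ε)))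
          ≡⟨ cong₂ _+_ (trans (total-◅◅ weight (forget a₁) b₂) (cong (_+ cost b₂) (cost-forget a₁)))
                       (trans (total-◅◅ weight (forget b₁) _) (cong₂ _+_ (cost-forget b₁) (total-◅◅ weight a₂ (K-sym (proj₁ k) ◅ ε)))) ⟩
        cost a₁ + cost b₂ + (cost b₁ + (cost a₂ + (weight y x + 0)))
          <⟨ +-cancelˡ-< (weight u v) _ _ (begin-strict
            weight u v + (cost a₁ + cost b₂ + (cost b₁ + (cost a₂ + (weight y x + 0))))
              ≡⟨ shuffle₁ (weight u v) (cost a₁) (cost b₂) (cost b₁) (cost a₂) (weight y x) ⟩
            cost a₁ + (weight u v + cost a₂) + (cost b₂ + cost b₁ + weight y x)
              <⟨ +-monoˡ-< (cost b₂ + cost b₁ + weight y x) detour-loses ⟩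
            cost q + weight x y + (cost b₂ + cost b₁ + weight y x)
              ≡⟨ shuffle₂ (cost q) (weight x y) (cost b₂) (cost b₁) (weight y x) ⟩
            weight x y + weight y x + (cost q + (cost b₁ + cost b₂))
              ≡⟨ cong (_+ (cost q + (cost b₁ + cost b₂))) (weight-antisym x y u v) ⟩
            weight u v + weight v u + (cost q + (cost b₁ + cost b₂))
              ≡⟨ shuffle₃ (weight u v) (weight v u) (cost q) (cost b₁) (cost b₂) ⟩
            weight u v + (cost q + (cost b₁ + (weight v u + cost b₂))) ∎) ⟩
        cost q + (cost b₁ + (weight v u + cost b₂))         ≡⟨ cong (cost q +_) cost-b ⟨
        cost q + cost b                                     ∎) ≤-refl
        where
        shuffle₁ : ∀ w a b c d z → w + (a + b + (c + (d + (z + 0)))) ≡ a + (w + d) + (b + c + z)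
        shuffle₁ = solve-∀
        shuffle₂ : ∀ q w b c z → q + w + (b + c + z) ≡ w + z + (q + (c + b))
        shuffle₂ = solve-∀
        shuffle₃ : ∀ w z q c b → w + z + (q + (c + b)) ≡ w + (q + (c + (z + b)))
        shuffle₃ = solve-∀

      orient : Hits (e ∷ []) u v → Hits (e ∷ []) u′ v′ → ⊥
      orient (inj₁ (here refl)) (inj₁ (here refl)) = same refl
      orient (inj₁ (here refl)) (inj₂ (here refl)) = opposite refl refl
      orient (inj₂ (here refl)) (inj₁ (here refl)) = opposite refl refl
      orient (inj₂ (here refl)) (inj₂ (here refl)) = same refl

    module _ {A B : Rel (Fin n) 0ℓ} (A⇒K : A ⇒ K) (B⇒K : B ⇒ K) {s t : Fin n}
             (keepA : ∀ {z} → Star K s z → ∃ λ (q : Star A s z) → Optimal s z (cost q))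
             (keepB : ∀ {z} → Star K t z → ∃ λ (q : Star B t z) → Optimal t z (cost q)) where

      Meeting : ℕ → Set
      Meeting m = ∃ λ z → Σ (Star (A ∖ (e ∷ [])) s z) λ q → Σ (Star (B ∖ (e ∷ [])) t z) λ r → len q + len r ≤ m

      into : ∀ {C : Rel (Fin n) 0ℓ} → C ⇒ K → (C ∖ (e ∷ [])) ⇒ K⁻
      into C⇒K (c , avoid) = C⇒K c , avoid

      short : ∀ {C s z} (C⇒K : C ⇒ K) (q : Star C s z) → Optimal s z (cost q) → (r : Star K⁻ s z) → len q ≤ len r
      short C⇒K q opt r = begin
        len q                  ≡⟨ total-map _ C⇒K q ⟨
        len (Star.map C⇒K q)   ≤⟨ cost-minimal⇒shortest (Star.map C⇒K q) (λ r → ≤-trans (≤-reflexive (total-map weight C⇒K q)) (opt r)) (Star.map proj₁ r) ⟩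
        len (Star.map proj₁ r) ≡⟨ total-map _ proj₁ r ⟩
        len r                  ∎
        where open ≤-Reasoning

      -- The recursion advances along `p` as long as the lightest kept walk from `s` avoids `e`. At
      -- the first failure, `no-crossing` makes the current vertex `x` the meeting point.
      restore : (p : Star K⁻ s t) → Minimal (λ _ _ → 1) p → Meeting (len p)
      restore p p-min = walk ε p ≤-refl ε (λ _ → z≤n)
        where
        walk : ∀ {x} (pa : Star K⁻ s x) (pb : Star K⁻ x t) → len pa + len pb ≤ len p →
               (q : Star (A ∖ (e ∷ [])) s x) → Optimal s x (cost q) → Meeting (len p)
        -- No failure occurred up to `t`, which is then the meeting point.
        walk pa ε le q opt = _ , q , ε , ≤-trans (+-monoˡ-≤ 0 (short (A⇒K ∘ proj₁) q opt pa)) le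
        walk {x} pa (_◅_ {j = y} k pb) le q opt
          with qy , qy-opt ← keepA (Star.map proj₁ (pa ◅◅ (k ◅ ε))) with firstUse e A⇒K qy
        ... | inj₁ (qy′ , eq) = walk (pa ◅◅ (k ◅ ε)) pb
                (≤-trans (≤-reflexive (trans (cong (_+ len pb) (total-◅◅ _ pa (k ◅ ε))) (+-assoc (len pa) 1 (len pb)))) le)
                qy′ (λ r → ≤-trans (≤-reflexive (eq weight)) (qy-opt r))
        ... | inj₂ (u , v , hit , a₁ , l , a₂ , eq)
          with back , back-len ← len-reverse K⁻-sym (k ◅ pb)
          with rx , rx-opt ← keepB (Star.map proj₁ back) with firstUse e B⇒K rx
        ...   | inj₁ (rx′ , eq′) = x , q , rx′ , ≤-trans (+-mono-≤
                  (short (A⇒K ∘ proj₁) q opt pa)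
                  (≤-trans (≤-reflexive (eq′ (λ _ _ → 1))) (≤-trans (short B⇒K rx rx-opt back) (≤-reflexive back-len)))) le
        ...   | inj₂ (u′ , v′ , hit′ , b₁ , m , b₂ , eq′) = ⊥-elim (no-crossing pa k pb
                  (λ r → ≤-trans le (p-min r))
                  (Star.map (into A⇒K) q) (λ r → ≤-trans (≤-reflexive (total-map weight (into A⇒K) q)) (opt r))
                  hit a₁ l a₂ (λ r → ≤-trans (≤-reflexive (sym (eq weight))) (qy-opt r))
                  hit′ b₁ m b₂ (λ r → ≤-trans (≤-reflexive (sym (eq′ weight))) (rx-opt r)))

-- Labels as bit strings

-- Each bijective base-2 digit is preceded by true; false ends a number.  In parse k, the function k
-- maps the value of the digits still to be read to the value of the whole number.
bits : ℕᵇ → List Bool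
bits 0ᵇ = false ∷ []
bits 2[1+ b ] = true ∷ false ∷ bits b
bits 1+[2 b ] = true ∷ true ∷ bits b

parse : (ℕ → ℕ) → List Bool → List ℕ
parse k [] = []
parse k (false ∷ bs) = k 0 ∷ parse (λ x → x) bs
parse k (true ∷ []) = []
parse k (true ∷ false ∷ bs) = parse (λ x → k (2 * suc x)) bs
parse k (true ∷ true ∷ bs) = parse (λ x → k (suc (2 * x))) bs

parse-bits : ∀ k b bs → parse k (bits b ++ bs) ≡ k (toℕᵇ b) ∷ parse (λ x → x) bs
parse-bits k 0ᵇ bs = refl
parse-bits k 2[1+ b ] bs = parse-bits (λ x → k (2 * suc x)) b bs
parse-bits k 1+[2 b ] bs = parse-bits (λ x → k (suc (2 * x))) b bs

numeral : ℕ → List Bool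
numeral x = bits (fromℕ x)

parse-numerals : ∀ xs → parse (λ x → x) (concatMap numeral xs) ≡ xs
parse-numerals [] = refl
parse-numerals (x ∷ xs) = trans (parse-bits (λ x → x) (fromℕ x) (concatMap numeral xs))
                                (cong₂ _∷_ (toℕ-fromℕ x) (parse-numerals xs))

-- Here `k` counts the digits. The least value with `k` digits has only ones, and each digit takes
-- two bits besides the terminator.
length-bits : ∀ b → ∃ λ k → length (bits b) ≡ suc (2 * k) × 2 ^ k ≤ suc (toℕᵇ b)
length-bits 0ᵇ = 0 , refl , s≤s z≤n
length-bits 2[1+ b ] with k , eq , le ← length-bits b =
  suc k , cong (2 +_) (trans eq (sym (+-suc k (k + 0)))) ,
  ≤-trans (*-monoʳ-≤ 2 le) (n≤1+n _)
length-bits 1+[2 b ] with k , eq , le ← length-bits b =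
  suc k , cong (2 +_) (trans eq (sym (+-suc k (k + 0)))) ,
  ≤-trans (*-monoʳ-≤ 2 le) (≤-reflexive (*-suc 2 (toℕᵇ b)))

length-numeral : ∀ {n x} → 1 ≤ n → x ≤ n → length (numeral x) ≤ 3 * (1 + ⌊log₂ n ⌋)
length-numeral {suc m} {x} _ x≤n with k , eq , le ← length-bits (fromℕ x) = begin
  length (numeral x)      ≡⟨ eq ⟩
  suc (2 * k)             ≤⟨ s≤s (*-monoʳ-≤ 2 k≤) ⟩
  suc (2 * (1 + ℓ))       ≤⟨ +-mono-≤ (s≤s (z≤n {ℓ})) ≤-refl ⟩
  3 * (1 + ℓ)             ∎
  where
  open ≤-Reasoning
  ℓ = ⌊log₂ suc m ⌋
  k≤ : k ≤ 1 + ℓ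
  k≤ = begin
    k                     ≡⟨ ⌊log₂[2^n]⌋≡n k ⟨
    ⌊log₂ 2 ^ k ⌋         ≤⟨ ⌊log₂⌋-mono-≤ (≤-trans le (s≤s (≤-trans (≤-reflexive (toℕ-fromℕ x)) x≤n))) ⟩
    -- For positive `n`, `n + 1` is at most `2 * n`, which costs just one extra digit.
    ⌊log₂ suc (suc m) ⌋   ≤⟨ ⌊log₂⌋-mono-≤ (≤-trans (s≤s (m≤n+m (suc m) m)) (≤-reflexive (cong (suc m +_) (sym (+-identityʳ (suc m)))))) ⟩
    ⌊log₂ 2 * suc m ⌋     ≡⟨ ⌊log₂[2*b]⌋≡1+⌊log₂b⌋ (suc m) ⟩
    1 + ℓ                 ∎

pairs : List ℕ → List (ℕ × ℕ)
pairs (a ∷ b ∷ xs) = (a , b) ∷ pairs xs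
pairs _ = []

module _ {n : ℕ} where

  flatten : List (Fin n × Fin n) → List ℕ
  flatten = concatMap λ (u , v) → toℕ u ∷ toℕ v ∷ []

  pairs-flatten : ∀ es → pairs (flatten es) ≡ map encodeEdge es
  pairs-flatten [] = refl
  pairs-flatten (e ∷ es) = cong (encodeEdge e ∷_) (pairs-flatten es)

  flatten≤ : ∀ es {x} → x ∈ flatten es → x ≤ n
  flatten≤ ((u , v) ∷ es) (here refl) = <⇒≤ (Fin.toℕ<n u)
  flatten≤ ((u , v) ∷ es) (there (here refl)) = <⇒≤ (Fin.toℕ<n v)
  flatten≤ (e ∷ es) (there (there m)) = flatten≤ es m

  length-flatten : ∀ es → length (flatten es) ≡ 2 * length es
  length-flatten [] = refl
  length-flatten (e ∷ es) = trans (cong (2 +_) (length-flatten es)) (sym (*-suc 2 (length es)))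

  -- The decoder is fixed before `n`, so each label starts with `n`.
  label : Fin n → List (Fin n × Fin n) → List Bool
  label s es = concatMap numeral (n ∷ toℕ s ∷ flatten es)

  length-label : ∀ s es → length (label s es) ≤ (2 + 2 * length es) * (3 * (1 + ⌊log₂ n ⌋))
  length-label s es = ≤-trans
    (length-concatMap numeral (3 * (1 + ⌊log₂ n ⌋)) (n ∷ toℕ s ∷ flatten es) (λ m → length-numeral 1≤n (bounded m)))
    (≤-reflexive (cong (λ k → (2 + k) * (3 * (1 + ⌊log₂ n ⌋))) (length-flatten es)))
    where
    1≤n : 1 ≤ n
    1≤n = ≤-trans (s≤s z≤n) (Fin.toℕ<n s)
    bounded : ∀ {x} → x ∈ n ∷ toℕ s ∷ flatten es → x ≤ n
    bounded (here refl) = ≤-refl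
    bounded (there (here refl)) = <⇒≤ (Fin.toℕ<n s)
    bounded (there (there m)) = flatten≤ es m

  ∈-encodeEdge⁻ : ∀ {u v : Fin n} {es} → (toℕ u , toℕ v) ∈ map encodeEdge es → (u , v) ∈ es
  ∈-encodeEdge⁻ {u} {v} m with (u′ , v′) , m′ , eq ← ∈-map⁻ encodeEdge m
    with refl ← Fin.toℕ-injective (cong proj₁ eq) | refl ← Fin.toℕ-injective (cong proj₂ eq) = m′

  distance : ∀ {K : Rel (Fin n) 0ℓ} → Decidable K → Fin n → Fin n → Maybe ℕ
  distance K? s t with reachable? K? s t
  ... | yes p = just (len (proj₁ (minimal K? (λ _ _ → 1) (λ _ _ → ≤-refl) p)))
  ... | no _ = nothing

-- Decoding

Joined : (n : ℕ) → List (ℕ × ℕ) → List (ℕ × ℕ) → Rel (Fin n) 0ℓ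
Joined n X F u v = ((toℕ u , toℕ v) ∈ X ⊎ (toℕ v , toℕ u) ∈ X)
  × ¬ ((toℕ u , toℕ v) ∈ F) × ¬ ((toℕ v , toℕ u) ∈ F)

open DecMembership (≡-dec _≟_ _≟_) using () renaming (_∈?_ to _∈ᵖ?_)

Joined? : ∀ n X F → Decidable (Joined n X F)
Joined? n X F u v = ((toℕ u , toℕ v) ∈ᵖ? X ⊎-dec (toℕ v , toℕ u) ∈ᵖ? X)
  ×-dec (¬? ((toℕ u , toℕ v) ∈ᵖ? F) ×-dec ¬? ((toℕ v , toℕ u) ∈ᵖ? F))

answer : (n s t : ℕ) → List (ℕ × ℕ) → List (ℕ × ℕ) → Maybe ℕ
answer n s t X F with s <? n | t <? n
... | yes s<n | yes t<n = distance (Joined? n X F) (fromℕ< s<n) (fromℕ< t<n)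
-- A default for malformed input; it never arises from labels of vertices.
... | _ | _ = nothing

answer-toℕ : ∀ {n} (s t : Fin n) X F → answer n (toℕ s) (toℕ t) X F ≡ distance (Joined? n X F) s t
answer-toℕ {n} s t X F with toℕ s <? n | toℕ t <? n
... | yes s<n | yes t<n = cong₂ (distance (Joined? n X F)) (Fin.fromℕ<-toℕ s s<n) (Fin.fromℕ<-toℕ t t<n)
... | yes _ | no ≮ = contradiction (Fin.toℕ<n t) ≮
... | no ≮ | _ = contradiction (Fin.toℕ<n s) ≮

combineLabels : List ℕ → List ℕ → List (ℕ × ℕ) → Maybe ℕ
combineLabels (n ∷ s ∷ xs) (_ ∷ t ∷ ys) F = answer n s t (pairs xs ++ pairs ys) F
combineLabels _ _ _ = nothing

decode : List Bool → List Bool → List (ℕ × ℕ) → Maybe ℕ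
decode Ls Lt = combineLabels (parse (λ x → x) Ls) (parse (λ x → x) Lt)

decode-label : ∀ {n} (s t : Fin n) es es′ F → decode (label s es) (label t es′) F
  ≡ distance (Joined? n (map encodeEdge es ++ map encodeEdge es′) F) s t
decode-label {n} s t es es′ F
  rewrite parse-numerals (n ∷ toℕ s ∷ flatten es) | parse-numerals (n ∷ toℕ t ∷ flatten es′)
        | pairs-flatten es | pairs-flatten es′ = answer-toℕ s t (map encodeEdge es ++ map encodeEdge es′) F

-- The labeling scheme

module Scheme (f : ℕ) {n : ℕ} (G : Graph n) where

  Arc : Rel (Fin n) 0ℓ
  Arc u v = adj G u v ≡ true

  Arc? : Decidable Arc
  Arc? u v = adj G u v ≟ᵇ true

  Arc-irr : ∀ {u} → ¬ Arc u u
  Arc-irr {u} eq with () ← trans (sym eq) (irrefl G u)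

  Arc-sym : Symmetric Arc
  Arc-sym {u} {v} eq = trans (Graph.sym G v u) eq

  inArcs : ∀ s v → Preserver f Arc v (s ∷ [])
  inArcs s v = preserver f Arc Arc? Arc-irr v (s ∷ [])

  candidates : Fin n → List (Fin n × Fin n)
  candidates s = concatMap (λ v → map (_, v) (proj₁ (inArcs s v))) (allFin n)

  -- A preserver may list vertices that are not adjacent to the target. The decoder could not
  -- recognise such pairs, so they are dropped here.
  edges : Fin n → List (Fin n × Fin n)
  edges s = filter (λ (u , v) → Arc? u v) (candidates s)

  Kept : Fin n → List (Fin n × Fin n) → Rel (Fin n) 0ℓ
  Kept s F u v = (Arc ∖ F) u v × (u , v) ∈ edges s

  -- The preserver at `v` supplies a last arc, and the walk before it is treated in the same way
  -- with its own end as target. Positive weights make the cost drop each time.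
  preserved : ∀ F → length F ≤ f → ∀ {s v} (p : Star (Arc ∖ F) s v) →
              ∃ λ (q : Star (Kept s F) s v) → cost q ≤ cost p
  preserved F F≤ {s} p = go (cost p) p ≤-refl
    where
    go : ∀ c {v} (p : Star (Arc ∖ F) s v) → cost p ≤ c → ∃ λ (q : Star (Kept s F) s v) → cost q ≤ cost p
    go c {v} p p≤c with s Fin.≟ v
    ... | yes refl = ε , z≤n
    ... | no s≢v with x , x∈E , q , k , le ← proj₂ (proj₂ (proj₂ (inArcs s v))) F F≤ (here refl) s≢v p = result c p≤c
      where
      kept : Kept s F x v
      kept = k , ∈-filter⁺ (λ (u , v) → Arc? u v)
        (∈-concatMap⁺ (λ v → map (_, v) (proj₁ (inArcs s v))) (lose (∈-allFin v) (∈-map⁺ (_, v) x∈E))) (proj₁ k)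
      lighter : suc (cost q) ≤ cost p
      lighter = ≤-trans (≤-trans (≤-reflexive (+-comm 1 (cost q))) (+-monoʳ-≤ (cost q) (weight>0 x v))) le
      result : ∀ c → cost p ≤ c → ∃ λ (q : Star (Kept s F) s v) → cost q ≤ cost p
      result zero p≤0 = contradiction (≤-trans lighter p≤0) λ ()
      result (suc c) p≤c with q′ , q′≤ ← go c q (≤-pred (≤-trans lighter p≤c)) =
        q′ ◅◅ (kept ◅ ε) , (begin
          cost (q′ ◅◅ (kept ◅ ε))                  ≡⟨ total-◅◅ weight q′ (kept ◅ ε) ⟩
          cost q′ + (weight x v + 0)               ≡⟨ cong (cost q′ +_) (+-identityʳ (weight x v)) ⟩
          cost q′ + weight x v                     ≤⟨ +-monoˡ-≤ (weight x v) q′≤ ⟩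
          cost q + weight x v                      ≤⟨ le ⟩
          cost p                                   ∎)
        where open ≤-Reasoning

  Surviving? : ∀ F → Decidable (Arc ∖ F)
  Surviving? F u v = Arc? u v ×-dec (¬? ((u , v) ∈? F) ×-dec ¬? ((v , u) ∈? F))

  optimal-kept : ∀ F → length F ≤ f → ∀ {s v} → Star (Arc ∖ F) s v →
                 ∃ λ (q : Star (Kept s F) s v) → ∀ (r : Star (Arc ∖ F) s v) → cost q ≤ cost r
  optimal-kept F F≤ p with π , min ← minimal (Surviving? F) weight weight>0 p with q , le ← preserved F F≤ π =
    q , λ r → ≤-trans le (min r)

  module _ (F : List (Fin n × Fin n)) (s t : Fin n) where

    Union : Rel (Fin n) 0ℓ
    Union = Joined n (map encodeEdge (edges s) ++ map encodeEdge (edges t)) (map encodeEdge F)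

    Union? : Decidable Union
    Union? = Joined? n (map encodeEdge (edges s) ++ map encodeEdge (edges t)) (map encodeEdge F)

    Union⇒ : Union ⇒ (Arc ∖ F)
    Union⇒ {u} {v} (e , ∉ , ∉′) = arc e , ∉ ∘ ∈-map⁺ encodeEdge , ∉′ ∘ ∈-map⁺ encodeEdge
      where
      arcOf : ∀ {u v : Fin n} → (toℕ u , toℕ v) ∈ map encodeEdge (edges s) ++ map encodeEdge (edges t) → Arc u v
      arcOf m with ∈-++⁻ (map encodeEdge (edges s)) m
      ... | inj₁ m′ = proj₂ (∈-filter⁻ (λ (u , v) → Arc? u v) {xs = candidates s} (∈-encodeEdge⁻ m′))
      ... | inj₂ m′ = proj₂ (∈-filter⁻ (λ (u , v) → Arc? u v) {xs = candidates t} (∈-encodeEdge⁻ m′))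
      arc : _ → Arc u v
      arc (inj₁ m) = arcOf m
      arc (inj₂ m) = Arc-sym (arcOf m)

    Union-sym : Symmetric Union
    Union-sym (inj₁ m , ∉ , ∉′) = inj₂ m , ∉′ , ∉
    Union-sym (inj₂ m , ∉ , ∉′) = inj₁ m , ∉′ , ∉

    unionˢ : ∀ {u v} → (Arc ∖ F) u v → (u , v) ∈ edges s → Union u v
    unionˢ (_ , ∉ , ∉′) m = inj₁ (∈-++⁺ˡ (∈-map⁺ encodeEdge m)) , ∉ ∘ ∈-encodeEdge⁻ , ∉′ ∘ ∈-encodeEdge⁻

    unionᵗ : ∀ {u v} → (Arc ∖ F) u v → (u , v) ∈ edges t → Union u v
    unionᵗ (_ , ∉ , ∉′) m =
      inj₁ (∈-++⁺ʳ (map encodeEdge (edges s)) (∈-map⁺ encodeEdge m)) , ∉ ∘ ∈-encodeEdge⁻ , ∉′ ∘ ∈-encodeEdge⁻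

  -- The head of the fault list plays `e` in the restoration, and the remaining faults are within
  -- the reach of the preservers. With no fault, the label of `s` suffices.
  spanned : ∀ F → length F ≤ suc f → ∀ {s t} (p : Star (Arc ∖ F) s t) → Minimal (λ _ _ → 1) p →
            ∃ λ (q : Star (Union F s t) s t) → len q ≤ len p
  spanned [] _ {s} {t} p _ with q , opt ← optimal-kept [] z≤n p =
    Star.map keep q , ≤-trans (≤-reflexive (total-map _ keep q)) (≤-trans (≤-reflexive (sym (total-map _ proj₁ q)))
      (cost-minimal⇒shortest (Star.map proj₁ q) (λ r → ≤-trans (≤-reflexive (total-map weight proj₁ q)) (opt r)) p))
    where
    keep : Kept s [] ⇒ Union [] s t
    keep (a , m) = unionˢ [] s t a m
  spanned (e ∷ F) F≤ {s} {t} p min = join (restore proj₁ proj₁ (optimal-kept F (≤-pred F≤)) (optimal-kept F (≤-pred F≤))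
    (Star.map split p)
    (λ r → ≤-trans (≤-reflexive (total-map _ split p)) (≤-trans (min (Star.map merge r)) (≤-reflexive (total-map _ merge r)))))
    where
    open Restoration (Arc ∖ F) (λ (a , ∉ , ∉′) → Arc-sym a , ∉′ , ∉) e
    split : (Arc ∖ (e ∷ F)) ⇒ K⁻
    split (a , ∉ , ∉′) = (a , ∉ ∘ there , ∉′ ∘ there) , (λ { (here eq) → ∉ (here eq) }) , λ { (here eq) → ∉′ (here eq) }
    merge : K⁻ ⇒ (Arc ∖ (e ∷ F))
    merge ((a , ∉ , ∉′) , ∉e , ∉e′) = a , (λ { (here eq) → ∉e (here eq) ; (there m) → ∉ m }) ,
      λ { (here eq) → ∉e′ (here eq) ; (there m) → ∉′ m }
    fromˢ : (Kept s F ∖ (e ∷ [])) ⇒ Union (e ∷ F) s t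
    fromˢ ((a , m) , avoid) = unionˢ (e ∷ F) s t (merge (a , avoid)) m
    fromᵗ : (Kept t F ∖ (e ∷ [])) ⇒ Union (e ∷ F) s t
    fromᵗ ((a , m) , avoid) = unionᵗ (e ∷ F) s t (merge (a , avoid)) m
    join : _ → ∃ λ (q : Star (Union (e ∷ F) s t) s t) → len q ≤ len p
    join (z , q , r , le) with r′ , eq ← len-reverse (Union-sym (e ∷ F) s t) (Star.map fromᵗ r) =
      Star.map fromˢ q ◅◅ r′ , (begin
        len (Star.map fromˢ q ◅◅ r′)            ≡⟨ total-◅◅ _ (Star.map fromˢ q) r′ ⟩
        len (Star.map fromˢ q) + len r′         ≡⟨ cong₂ _+_ (total-map _ fromˢ q) (trans eq (total-map _ fromᵗ r)) ⟩
        len q + len r                           ≤⟨ le ⟩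
        len (Star.map split p)                  ≡⟨ total-map _ split p ⟩
        len p                                   ∎)
      where open ≤-Reasoning

  toWalk : ∀ {F s t} (p : Star (Arc ∖ F) s t) → Walk G F s t (len p)
  toWalk ε = nil
  toWalk (k ◅ p) = cons k (toWalk p)

  fromWalk : ∀ {F s t k} → Walk G F s t k → ∃ λ (p : Star (Arc ∖ F) s t) → len p ≡ k
  fromWalk nil = ε , refl
  fromWalk (cons k w) with p , eq ← fromWalk w = k ◅ p , cong suc eq

  -- Distances in `Union` are not too small because its arcs survive in `G`, and not too large by
  -- `spanned`.
  distance-correct : ∀ F → length F ≤ suc f → ∀ s t →
    IsDist G F s t (distance (Union? F s t) s t)
  distance-correct F F≤ s t with reachable? (Union? F s t) s t
  ... | no unreachable = λ k w → unreachable (span (proj₁ (fromWalk w)))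
    where
    span : Star (Arc ∖ F) s t → Star (Union F s t) s t
    span p = let π , min = minimal (Surviving? F) (λ _ _ → 1) (λ _ _ → ≤-refl) p in proj₁ (spanned F F≤ π min)
  ... | yes p = subst (Walk G F s t) (total-map _ (Union⇒ F s t) π) (toWalk (Star.map (Union⇒ F s t) π)) , shortest
    where
    π = proj₁ (minimal (Union? F s t) (λ _ _ → 1) (λ _ _ → ≤-refl) p)
    π-min : Minimal (λ _ _ → 1) π
    π-min = proj₂ (minimal (Union? F s t) (λ _ _ → 1) (λ _ _ → ≤-refl) p)
    shortest : ∀ k → Walk G F s t k → len π ≤ k
    shortest k w with r , eq ← fromWalk w with r′ , r′-min ← minimal (Surviving? F) (λ _ _ → 1) (λ _ _ → ≤-refl) r
      with q , le ← spanned F F≤ r′ r′-min = ≤-trans (π-min q) (≤-trans le (≤-trans (r′-min r) (≤-reflexive eq)))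

  private p = 2 ^ f

  Fits : ℕ → Set
  Fits = Small n f (factor f) 1

  -- The sizes are bounded only through their powers, so a maximum is used in place of a root.
  -- Starting it at 1 lets it absorb the two header numbers of a label.
  common-bound : 1 ≤ n → ∀ (g : Fin n → ℕ) (vs : List (Fin n)) → (∀ v → Fits (g v)) →
                 ∃ λ B → 1 ≤ B × Fits B × (∀ {v} → v ∈ vs → g v ≤ B)
  common-bound 1≤n g [] fits = 1 , ≤-refl , one , λ ()
    where
    one : Fits 1
    one = ≤-trans (≤-reflexive (^-zeroˡ p)) (*-mono-≤ (m^n>0 (factor f) {{factor≢0 f}} p)
      (≤-trans (m^n>0 n {{>-nonZero 1≤n}} (p ∸ 1)) (≤-reflexive (sym (*-identityˡ _)))))
  common-bound 1≤n g (v ∷ vs) fits with B , 1≤B , fitsB , g≤B ← common-bound 1≤n g vs fits =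
    g v ⊔ B , ≤-trans 1≤B (m≤n⊔m (g v) B) , sup ,
    λ { (here refl) → m≤m⊔n (g v) B ; (there m) → ≤-trans (g≤B m) (m≤n⊔m (g v) B) }
    where
    sup : Fits (g v ⊔ B)
    sup with ⊔-sel (g v) B
    ... | inj₁ eq rewrite eq = fits v
    ... | inj₂ eq rewrite eq = fitsB

  scheme : Fin n → List Bool
  scheme s = label s (edges s)

  -- At most `4 * (n * B)` numbers of at most `3 * ℓ` bits each give the constant 12. The powers of
  -- `n` combine because `p + (p - 1)` is `2 ^ suc f - 1`.
  length-scheme : ∀ s → length (scheme s) ^ p ≤ ((12 * factor f) * (1 + ⌊log₂ n ⌋) ^ 1) ^ p * n ^ (2 ^ suc f ∸ 1)
  length-scheme s with B , 1≤B , fits , E≤B ← common-bound (≤-trans (s≤s z≤n) (Fin.toℕ<n s)) (λ v → length (proj₁ (inArcs s v))) (allFin n)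
                                                (λ v → proj₁ (proj₂ (inArcs s v))) = begin
    length (scheme s) ^ p                         ≤⟨ ^-monoˡ-≤ p (≤-trans (length-label s (edges s)) (*-monoˡ-≤ (3 * ℓ) count)) ⟩
    (4 * (n * B) * (3 * ℓ)) ^ p                   ≡⟨ cong (_^ p) (regroup n B ℓ) ⟩
    (12 * ℓ * (n * B)) ^ p                        ≡⟨ trans (^-distribʳ-* (12 * ℓ) (n * B) p) (cong ((12 * ℓ) ^ p *_) (^-distribʳ-* n B p)) ⟩
    (12 * ℓ) ^ p * (n ^ p * B ^ p)                ≤⟨ *-monoʳ-≤ ((12 * ℓ) ^ p) (*-monoʳ-≤ (n ^ p) fits) ⟩
    (12 * ℓ) ^ p * (n ^ p * (C ^ p * (1 * m)))    ≡⟨ cong (λ z → (12 * ℓ) ^ p * (n ^ z * (C ^ p * (1 * m)))) (suc-2^∸1 f) ⟨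
    (12 * ℓ) ^ p * (n * m * (C ^ p * (1 * m)))    ≡⟨ gather ((12 * ℓ) ^ p) n m (C ^ p) ⟩
    (12 * ℓ) ^ p * C ^ p * (n * (m * m))          ≡⟨ cong₂ _*_ (^-distribʳ-* (12 * ℓ) C p) (^-double∸1 n f) ⟨
    (12 * ℓ * C) ^ p * n ^ (2 ^ suc f ∸ 1)        ≡⟨ cong (λ z → z ^ p * n ^ (2 ^ suc f ∸ 1)) (reorder ℓ C) ⟩
    (12 * C * ℓ ^ 1) ^ p * n ^ (2 ^ suc f ∸ 1)    ∎
    where
    open ≤-Reasoning
    ℓ = 1 + ⌊log₂ n ⌋
    C = factor f
    m = n ^ (p ∸ 1)
    1≤n : 1 ≤ n
    1≤n = ≤-trans (s≤s z≤n) (Fin.toℕ<n s)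
    regroup : ∀ n b l → 4 * (n * b) * (3 * l) ≡ 12 * l * (n * b)
    regroup = solve-∀
    gather : ∀ a n m c → a * (n * m * (c * (1 * m))) ≡ a * c * (n * (m * m))
    gather = solve-∀
    reorder : ∀ l c → 12 * l * c ≡ 12 * c * (l * 1)
    reorder = solve-∀
    double : ∀ a → 2 * a + 2 * a ≡ 4 * a
    double = solve-∀
    edges≤ : length (edges s) ≤ n * B
    edges≤ = begin
      length (edges s)       ≤⟨ length-filter (λ (u , v) → Arc? u v) (candidates s) ⟩
      length (candidates s)  ≤⟨ length-concatMap _ B (allFin n) (λ {v} v∈ → ≤-trans (≤-reflexive (length-map (_, v) (proj₁ (inArcs s v)))) (E≤B v∈)) ⟩
      length (allFin n) * B  ≡⟨ cong (_* B) (length-tabulate {n = n} (λ i → i)) ⟩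
      n * B                  ∎
    count : 2 + 2 * length (edges s) ≤ 4 * (n * B)
    count = begin
      2 + 2 * length (edges s)       ≤⟨ +-mono-≤ (*-monoʳ-≤ 2 (*-mono-≤ 1≤n 1≤B)) (*-monoʳ-≤ 2 edges≤) ⟩
      2 * (n * B) + 2 * (n * B)      ≡⟨ double (n * B) ⟩
      4 * (n * B)                    ∎

theorem25 : (f : ℕ) → ∃[ c ] ∃[ k ]
    Σ (List Bool → List Bool → List (ℕ × ℕ) → Maybe ℕ) λ decode →
    (n : ℕ) (G : Graph n) →
    Σ (Fin n → List Bool) λ L →
    ((v : Fin n) → length (L v) ^ (2 ^ f)
    ≤ (c * (1 + ⌊log₂ n ⌋) ^ k) ^ (2 ^ f) * n ^ (2 ^ (suc f) ∸ 1))
    × ((F : List (Fin n × Fin n)) → length F ≤ suc f → All (IsEdge G) F →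
    (s t : Fin n) → IsDist G F s t (decode (L s) (L t) (map encodeEdge F)))
-- A single logarithmic factor suffices, namely the length of one stored number.
theorem25 f = 12 * factor f , 1 , decode , λ n G → let open Scheme f G in
  scheme , length-scheme , λ F F≤ _ s t →
    subst (IsDist G F s t) (sym (decode-label s t (edges s) (edges t) (map encodeEdge F))) (distance-correct F F≤ s t)
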